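{- Let $V$ be a nonempty finite set and let $B \subseteq \mathbb{Z}^V$ be a nonempty set. The following three conditions are equivalent. (a) $B$ is BS-convex, i.e., $B = \mathrm{P}(f) \cap \mathbb{Z}^V$ for some integral bisubmodular function $f : \{ -1,0,1\}^V \to \mathbb{Z} \cup \{+\infty\}$ with $f(\mathbf{0}) = 0$. (b) $B$ satisfies ($\Delta$-EXC): for any $p, q \in B$ and any $u \in \operatorname{supp}(q-p)$, there exists $\alpha \in \Phi_B(p,q)$ with $u \in \operatorname{supp}(\alpha)$. (c) $B$ satisfies (BS-EXC): for any $p, q \in B$, there exist $\alpha_1, \dots, \alpha_k \in \Phi_B(p,q)$ (not necessarily distinct, $k \ge 0$) such that $p + \sum_{i=1}^k \alpha_i/2 = q$.
   Context: For $t \in \mathbb{R}^V$, $\operatorname{supp}(t) = \{u \in V : t(u) \neq 0\}$; $\|p\|_1 = \sum_{u \in V}|p(u)|$; $\chi_u$ is the $u$-th unit vector; $\langle p, x\rangle = \sum_{u} p(u)x(u)$. Let $\Phi = \{\pm \chi_u : u \in V\} \cup \{\pm\chi_u \pm \chi_v : u, v \in V, u \ne v\}$ (the vectors in $\{ -1,0,1\}^V$ of 1-norm 1 or 2). For $p, q \in \mathbb{Z}^V$, $\Phi(p,q) = \{\alpha \in \Phi : \|q - (p+\alpha)\|_1 = \|q-p\|_1 - \|\alpha\|_1\}$, and for $B \subseteq \mathbb{Z}^V$ and $p,q \in B$, $\Phi_B(p,q) = \{\alpha \in \Phi(p,q) : p + \alpha \in B\}$. For $x, y \in \{ -1,0,1\}^V$,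 define coordinatewise $(x \sqcap y)(u) = x(u)$ if $x(u)=y(u)$ and $0$ otherwise; $(x \sqcup y)(u) = x(u)$ if $x(u)=y(u)$ or $y(u)=0$, $= y(u)$ if $x(u)=0$, and $=0$ if $0 \ne x(u) \ne y(u) \ne 0$. A function $f : \{ -1,0,1\}^V \to \mathbb{R}\cup\{+\infty\}$ with $f(\mathbf{0})=0$ is bisubmodular if $f(x)+f(y) \ge f(x\sqcap y) + f(x \sqcup y)$ for all $x,y$; it is integral if all its finite values are integers. Its bisubmodular polyhedron is $\mathrm{P}(f) = \{p \in \mathbb{R}^V : \langle p, x\rangle \le f(x) \ \forall x \in \{ -1,0,1\}^V\}$. -}

module Defs where

open import Level using (Level; 0ℓ)
open import Data.Nat.Base using (ℕ)
open import Data.Integer.Base as ℤ using (ℤ; +_; 0ℤ; 1ℤ; -1ℤ; ∣_∣; _◃_)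
open import Data.Rational.Base as ℚ using (ℚ; 0ℚ; _/_)
open import Data.Sign.Base using (Sign)
open import Data.Fin.Base using (Fin)
open import Data.List.Base as List using (List)
open import Data.List.Relation.Unary.All using (All)
open import Data.Vec.Base as Vec using (Vec; lookup; replicate; zipWith; _[_]≔_)
open import Data.Product.Base using (∃-syntax; _×_)
open import Data.Sum.Base using (_⊎_)
open import Relation.Unary using (Pred; _∈_; _≐_)
open import Relation.Binary.PropositionalEquality.Core using (_≡_; _≢_)
open import Relation.Nullary.Construct.Add.Supremum using (_⁺; [_]; ⊤⁺)
open import Relation.Binary.Construct.Add.Supremum.NonStrict ℤ._≤_ using (_≤⁺_)

private
  variable
    ℓ : Level
    n : ℕ

infixl 6 _⊕_ _⊖_ _⊕ℚ_ _+⁺_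
infixr 7 _⊓_ _⊔_ _⊓ᵛ_ _⊔ᵛ_
infixl 7 _·χ_

-- The ground set V is Fin n, and ℤ^V is Vec ℤ n, so that propositional
-- equality of points is coordinatewise equality.

Point : ℕ → Set
Point n = Vec ℤ n

_⊕_ _⊖_ : Point n → Point n → Point n
_⊕_ = zipWith ℤ._+_
_⊖_ = zipWith ℤ._-_

supp : Point n → Pred (Fin n) 0ℓ
supp t u = lookup t u ≢ 0ℤ

‖_‖₁ : Point n → ℕ
‖ p ‖₁ = Vec.sum (Vec.map ∣_∣ p)

χ : Fin n → Point n
χ {n} u = replicate n 0ℤ [ u ]≔ 1ℤ

_·χ_ : Sign → Fin n → Point n
s ·χ u = Vec.map ((s ◃ 1) ℤ.*_) (χ u)

Φ : Pred (Point n) 0ℓ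
Φ α = (∃[ s ] ∃[ u ] α ≡ s ·χ u)
    ⊎ (∃[ s ] ∃[ t ] ∃[ u ] ∃[ v ] u ≢ v × α ≡ s ·χ u ⊕ t ·χ v)

-- The difference of norms is taken in ℤ to avoid truncated subtraction.
Φ⟨_,_⟩ : Point n → Point n → Pred (Point n) 0ℓ
Φ⟨ p , q ⟩ α =
  α ∈ Φ × + ‖ q ⊖ (p ⊕ α) ‖₁ ≡ + ‖ q ⊖ p ‖₁ ℤ.- + ‖ α ‖₁

Φ[_]⟨_,_⟩ : Pred (Point n) ℓ → Point n → Point n → Pred (Point n) ℓ
Φ[ B ]⟨ p , q ⟩ α = α ∈ Φ⟨ p , q ⟩ × (p ⊕ α) ∈ B

-- The three-element set {-1, 0, 1}.
data Trit : Set where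
  -1ₜ 0ₜ 1ₜ : Trit

tritToℤ : Trit → ℤ
tritToℤ -1ₜ = -1ℤ
tritToℤ 0ₜ  = 0ℤ
tritToℤ 1ₜ  = 1ℤ

_⊓_ : Trit → Trit → Trit
-1ₜ ⊓ -1ₜ = -1ₜ
-1ₜ ⊓ 0ₜ  = 0ₜ
-1ₜ ⊓ 1ₜ  = 0ₜ
0ₜ  ⊓ _   = 0ₜ
1ₜ  ⊓ -1ₜ = 0ₜ
1ₜ  ⊓ 0ₜ  = 0ₜ
1ₜ  ⊓ 1ₜ  = 1ₜ

_⊔_ : Trit → Trit → Trit
-1ₜ ⊔ -1ₜ = -1ₜ
-1ₜ ⊔ 0ₜ  = -1ₜ
-1ₜ ⊔ 1ₜ  = 0ₜ
0ₜ  ⊔ y   = y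
1ₜ  ⊔ -1ₜ = 0ₜ
1ₜ  ⊔ 0ₜ  = 1ₜ
1ₜ  ⊔ 1ₜ  = 1ₜ

_⊓ᵛ_ _⊔ᵛ_ : Vec Trit n → Vec Trit n → Vec Trit n
_⊓ᵛ_ = zipWith _⊓_
_⊔ᵛ_ = zipWith _⊔_

⟪_,_⟫ : Point n → Vec Trit n → ℤ
⟪ p , x ⟫ = Vec.foldr′ ℤ._+_ 0ℤ (zipWith (λ a t → a ℤ.* tritToℤ t) p x)

-- ℤ ⁺ is ℤ ∪ {+∞}.
_+⁺_ : ℤ ⁺ → ℤ ⁺ → ℤ ⁺
[ a ] +⁺ [ b ] = [ a ℤ.+ b ]
[ _ ] +⁺ ⊤⁺    = ⊤⁺
⊤⁺    +⁺ _     = ⊤⁺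

record IsIntegralBisubmodular (f : Vec Trit n → ℤ ⁺) : Set where
  field
    f0≡0         : f (replicate n 0ₜ) ≡ [ 0ℤ ]
    bisubmodular : ∀ x y → f (x ⊓ᵛ y) +⁺ f (x ⊔ᵛ y) ≤⁺ f x +⁺ f y

-- The integer points P(f) ∩ ℤ^V of the bisubmodular polyhedron of f.
Pℤ : (Vec Trit n → ℤ ⁺) → Pred (Point n) 0ℓ
Pℤ f p = ∀ x → [ ⟪ p , x ⟫ ] ≤⁺ f x

BS-Convex : Pred (Point n) ℓ → Set ℓ
BS-Convex B = ∃[ f ] IsIntegralBisubmodular f × B ≐ Pℤ f

Δ-EXC : Pred (Point n) ℓ → Set ℓ
Δ-EXC B = ∀ p q → p ∈ B → q ∈ B → ∀ u → u ∈ supp (q ⊖ p) →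
  ∃[ α ] α ∈ Φ[ B ]⟨ p , q ⟩ × u ∈ supp α

_⊕ℚ_ : Vec ℚ n → Vec ℚ n → Vec ℚ n
_⊕ℚ_ = zipWith ℚ._+_

toℚⱽ half : Point n → Vec ℚ n
toℚⱽ = Vec.map (_/ 1)
half = Vec.map (_/ 2)

sumℚⱽ : List (Vec ℚ n) → Vec ℚ n
sumℚⱽ {n} = List.foldr _⊕ℚ_ (replicate n 0ℚ)

BS-EXC : Pred (Point n) ℓ → Set ℓ
BS-EXC B = ∀ p q → p ∈ B → q ∈ B →
  ∃[ αs ] All (_∈ Φ[ B ]⟨ p , q ⟩) αs
        × toℚⱽ p ⊕ℚ sumℚⱽ (List.map half αs) ≡ toℚⱽ q

{-# OPTIONS --safe #-}

-- Write e for a signed element ±u, p ▷ e for p ± χ_u, and call e directed from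
-- p towards q if q is farther than p in direction e.
--
-- (a) ⇒ (b): the functionals tight at p are closed under ⊓ and ⊔.  If p ▷ e
-- leaves P(f), take the least tight D with D(e) = 1.  As ⟨q, D⟩ ≤ ⟨p, D⟩, some
-- direction g from p to q has D(g) = −1, and uncrossing with D shows that
-- p ▷ e ▷ g stays in P(f).
--
-- (b) ⇒ (a): f is the support function of B.  For x ⊑ y, pulling a maximiser of
-- y towards a maximiser of x never decreases y, so x and y have a common
-- maximiser; applied to x ⊓ y ⊑ x ⊔ y this is bisubmodularity.  If q ∈ P(f) is
-- not in B, let p ∈ B be closest to q: the directions from p to q, together
-- with the opposites of all elements exchangeable with one of them at p, form a
-- functional that no move of Φ at p increases.  Such a local maximum is a
-- maximum over B, yet q exceeds it.
--
-- (b) ⇒ (c): Hall's theorem for the graph Φ_B(p, q) on the coordinates with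
-- demands |q − p|.  Hall's condition for S is again the local-to-global
-- principle, for the functional ±(S − N(S)).
--
-- (c) ⇒ (b): some α_i must be nonzero at u.
module Submission where

open import Defs
open import Level using (Level; Lift; lift; lower; 0ℓ)
open import Axiom.ExcludedMiddle using (ExcludedMiddle)
open import Data.Empty using (⊥)
open import Data.Nat.Base as ℕ using (ℕ; zero; suc; NonZero)
import Data.Nat.Properties as ℕ
open import Data.Integer.Base as ℤ using (ℤ; +_; -[1+_]; +[1+_]; 0ℤ; 1ℤ; -1ℤ; ∣_∣; _◃_; +<+; +≤+; -≤+; -≤-)
import Data.Integer.Properties as ℤ
open import Data.Integer.Tactic.RingSolver using (solve-∀)
open import Algebra.Properties.CommutativeMonoid.Sum ℕ.+-0-commutativeMonoid using (sum-cong-≗; ∑-distrib-+; sum-replicate-zero)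
  renaming (sum to ∑)
open import Data.Bool.Base using (Bool; true; false; if_then_else_; _∧_; _∨_)
import Data.Bool.Properties as Bool
open import Data.Rational.Base as ℚ using (0ℚ; _/_; fromℚᵘ)
import Data.Rational.Properties as ℚ
open import Data.Rational.Unnormalised.Base as ℚᵘ using (mkℚᵘ; *≡*)
import Data.Rational.Unnormalised.Properties as ℚᵘ
open import Data.Sign.Base as Sign using (Sign)
import Data.Sign.Properties as Sign
open import Data.Fin.Base using (Fin; zero; suc)
import Data.Fin.Properties as Fin
open import Data.List.Base as List using (List; []; _∷_)
open import Data.List.Relation.Unary.All as All using (All; []; _∷_)
import Data.List.Relation.Unary.All.Properties as All
open import Data.List.Relation.Unary.All.Properties using (¬Any⇒All¬)
open import Data.List.Relation.Unary.Any as Any using (here; there)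
open import Data.List.Membership.Propositional.Properties using (∈-allFin)
open import Data.List.Membership.Propositional using (find) renaming (_∈_ to _∈ˡ_)
open import Data.Vec.Base as Vec using (Vec; []; _∷_; lookup; replicate; tabulate; _[_]%=_)
import Data.Vec.Properties as Vec
open import Data.Product.Base using (_×_; _,_; proj₁; proj₂; ∃-syntax)
import Data.Product.Properties as Product
open import Data.Sum.Base using (_⊎_; inj₁; inj₂)
open import Function.Base using (_∘_; case_of_)
open import Relation.Nullary using (Dec; yes; no; ¬_; contradiction)
open import Relation.Nullary.Decidable as Dec using (map′; does; decidable-stable; _×-dec_; _⊎-dec_)
open import Relation.Unary using (Pred; Satisfiable; _∈_; _∉_; _≐_)
open import Function.Bundles using (_⇔_; mk⇔)
import Relation.Binary.Reasoning.Setoid as ≈-Reasoning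
open import Relation.Nullary.Construct.Add.Supremum using (_⁺; [_]; ⊤⁺)
open import Relation.Binary.Construct.Add.Supremum.NonStrict ℤ._≤_ using (_≤⁺_; _≤⊤⁺; [≤]-injective; ≤⁺-trans)
  renaming ([_] to ≤[_])
open import Relation.Binary.PropositionalEquality

private
  variable
    ℓ : Level
    n : ℕ

-- Signed elements

Signed : ℕ → Set
Signed n = Fin n × Sign

opp : Signed n → Signed n
opp (u , s) = u , Sign.opposite s

infixl 6 _▷_ _▷*_
infix 9 _⟨_⟩
infix 4 _≟ₛ_

_▷_ : Point n → Signed n → Point n
p ▷ (u , s) = p ⊕ s ·χ u

_▷*_ : Point n → List (Signed n) → Point n
_▷*_ = List.foldl _▷_

-- The coordinate is negated along a negative element, so a step along `e` always raises `_⟨ e ⟩` by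
-- one and a single inequality serves both signs.
_⟨_⟩ : Point n → Signed n → ℤ
p ⟨ u , Sign.+ ⟩ = lookup p u
p ⟨ u , Sign.- ⟩ = ℤ.- lookup p u

-- A record, so that p, q and e can be inferred.
record Toward (p q : Point n) (e : Signed n) : Set where
  constructor toward
  field gap> : p ⟨ e ⟩ ℤ.< q ⟨ e ⟩
open Toward

opp-involutive : (e : Signed n) → opp (opp e) ≡ e
opp-involutive (u , s) = cong (u ,_) (Sign.opposite-involutive s)

e≢opp : {e : Signed n} → e ≢ opp e
e≢opp {e = u , Sign.+} ()
e≢opp {e = u , Sign.-} ()

_≟ₛ_ : (e f : Signed n) → Dec (e ≡ f)
_≟ₛ_ = Product.≡-dec Fin._≟_ Sign._≟_

same-base : (e f : Signed n) → f ≡ e ⊎ f ≡ opp e ⊎ proj₁ e ≢ proj₁ f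
same-base (u , s) (v , t) with u Fin.≟ v
... | no u≢v = inj₂ (inj₂ u≢v)
same-base (u , Sign.+) (u , Sign.+) | yes refl = inj₁ refl
same-base (u , Sign.+) (u , Sign.-) | yes refl = inj₂ (inj₁ refl)
same-base (u , Sign.-) (u , Sign.+) | yes refl = inj₂ (inj₁ refl)
same-base (u , Sign.-) (u , Sign.-) | yes refl = inj₁ refl

⊕-identityʳ : (p : Point n) → p ⊕ replicate n 0ℤ ≡ p
⊕-identityʳ = Vec.zipWith-identityʳ ℤ.+-identityʳ

⊕-assoc : (p q r : Point n) → (p ⊕ q) ⊕ r ≡ p ⊕ (q ⊕ r)
⊕-assoc = Vec.zipWith-assoc ℤ.+-assoc

⊕-comm : (p q : Point n) → p ⊕ q ≡ q ⊕ p
⊕-comm = Vec.zipWith-comm ℤ.+-comm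

lookup-ext : ∀ {a} {A : Set a} {p q : Vec A n} → (∀ u → lookup p u ≡ lookup q u) → p ≡ q
lookup-ext {p = p} {q} eq =
  trans (sym (Vec.tabulate∘lookup p)) (trans (Vec.tabulate-cong eq) (Vec.tabulate∘lookup q))

▷-comm : (p : Point n) (e f : Signed n) → p ▷ e ▷ f ≡ p ▷ f ▷ e
▷-comm p (u , s) (v , t) = begin
  (p ⊕ s ·χ u) ⊕ t ·χ v  ≡⟨ ⊕-assoc p _ _ ⟩
  p ⊕ (s ·χ u ⊕ t ·χ v)  ≡⟨ cong (p ⊕_) (⊕-comm _ _) ⟩
  p ⊕ (t ·χ v ⊕ s ·χ u)  ≡⟨ ⊕-assoc p _ _ ⟨
  (p ⊕ t ·χ v) ⊕ s ·χ u  ∎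
  where open ≡-Reasoning

▷-updateAt : (p : Point n) (u : Fin n) (s : Sign) → p ▷ (u , s) ≡ p [ u ]%= (ℤ._+ (s ◃ 1))
▷-updateAt {suc n} (a ∷ p) zero s = cong₂ _∷_ (cong (ℤ._+_ a) (ℤ.*-identityʳ (s ◃ 1))) (begin
  p ⊕ Vec.map ((s ◃ 1) ℤ.*_) (replicate n 0ℤ)  ≡⟨ cong (p ⊕_) (Vec.map-replicate _ 0ℤ n) ⟩
  p ⊕ replicate n ((s ◃ 1) ℤ.* 0ℤ)             ≡⟨ cong (λ z → p ⊕ replicate n z) (ℤ.*-zeroʳ (s ◃ 1)) ⟩
  p ⊕ replicate n 0ℤ                           ≡⟨ ⊕-identityʳ p ⟩
  p                                            ∎)
  where open ≡-Reasoning
▷-updateAt (a ∷ p) (suc u) s =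
  cong₂ _∷_ (trans (cong (ℤ._+_ a) (ℤ.*-zeroʳ (s ◃ 1))) (ℤ.+-identityʳ a)) (▷-updateAt p u s)

lookup-▷ : (p : Point n) (u : Fin n) (s : Sign) → lookup (p ▷ (u , s)) u ≡ lookup p u ℤ.+ (s ◃ 1)
lookup-▷ p u s = trans (cong (λ r → lookup r u) (▷-updateAt p u s)) (Vec.lookup∘updateAt u p)

lookup-▷-≢ : (p : Point n) (u v : Fin n) (s : Sign) → u ≢ v → lookup (p ▷ (u , s)) v ≡ lookup p v
lookup-▷-≢ p u v s u≢v =
  trans (cong (λ r → lookup r v) (▷-updateAt p u s)) (Vec.lookup∘updateAt′ v u (u≢v ∘ sym) p)

⟨opp⟩ : (p : Point n) (e : Signed n) → p ⟨ opp e ⟩ ≡ ℤ.- p ⟨ e ⟩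
⟨opp⟩ p (u , Sign.+) = refl
⟨opp⟩ p (u , Sign.-) = sym (ℤ.neg-involutive _)

▷-same : (p : Point n) (e : Signed n) → (p ▷ e) ⟨ e ⟩ ≡ 1ℤ ℤ.+ p ⟨ e ⟩
▷-same p (u , Sign.+) = trans (lookup-▷ p u Sign.+) (ℤ.+-comm (lookup p u) 1ℤ)
▷-same p (u , Sign.-) = trans (cong ℤ.-_ (lookup-▷ p u Sign.-))
  (trans (ℤ.neg-distrib-+ (lookup p u) -1ℤ) (ℤ.+-comm (ℤ.- lookup p u) 1ℤ))

▷-opp : (p : Point n) (e : Signed n) → (p ▷ e) ⟨ opp e ⟩ ≡ -1ℤ ℤ.+ p ⟨ opp e ⟩
▷-opp p e = begin
  (p ▷ e) ⟨ opp e ⟩      ≡⟨ ⟨opp⟩ (p ▷ e) e ⟩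
  ℤ.- (p ▷ e) ⟨ e ⟩      ≡⟨ cong ℤ.-_ (▷-same p e) ⟩
  ℤ.- (1ℤ ℤ.+ p ⟨ e ⟩)   ≡⟨ ℤ.neg-distrib-+ 1ℤ (p ⟨ e ⟩) ⟩
  -1ℤ ℤ.- p ⟨ e ⟩        ≡⟨ cong (ℤ._+_ -1ℤ) (⟨opp⟩ p e) ⟨
  -1ℤ ℤ.+ p ⟨ opp e ⟩    ∎
  where open ≡-Reasoning

▷-other : (p : Point n) (e f : Signed n) → proj₁ e ≢ proj₁ f → (p ▷ e) ⟨ f ⟩ ≡ p ⟨ f ⟩
▷-other p (u , s) (v , Sign.+) u≢v = lookup-▷-≢ p u v s u≢v
▷-other p (u , s) (v , Sign.-) u≢v = cong ℤ.-_ (lookup-▷-≢ p u v s u≢v)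

▷-inverse : (p : Point n) (e : Signed n) → p ▷ e ▷ opp e ≡ p
▷-inverse p e = lookup-ext λ v → along (v , Sign.+)
  where
  same : (p ▷ e ▷ opp e) ⟨ e ⟩ ≡ p ⟨ e ⟩
  same = begin
    (p ▷ e ▷ opp e) ⟨ e ⟩                ≡⟨ cong ((p ▷ e ▷ opp e) ⟨_⟩) (opp-involutive e) ⟨
    (p ▷ e ▷ opp e) ⟨ opp (opp e) ⟩      ≡⟨ ▷-opp (p ▷ e) (opp e) ⟩
    -1ℤ ℤ.+ (p ▷ e) ⟨ opp (opp e) ⟩      ≡⟨ cong (λ f → -1ℤ ℤ.+ (p ▷ e) ⟨ f ⟩) (opp-involutive e) ⟩
    -1ℤ ℤ.+ (p ▷ e) ⟨ e ⟩                ≡⟨ cong (ℤ._+_ -1ℤ) (▷-same p e) ⟩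
    -1ℤ ℤ.+ (1ℤ ℤ.+ p ⟨ e ⟩)             ≡⟨ ℤ.+-assoc -1ℤ 1ℤ (p ⟨ e ⟩) ⟨
    0ℤ ℤ.+ p ⟨ e ⟩                       ≡⟨ ℤ.+-identityˡ _ ⟩
    p ⟨ e ⟩                              ∎
    where open ≡-Reasoning
  along : ∀ f → (p ▷ e ▷ opp e) ⟨ f ⟩ ≡ p ⟨ f ⟩
  along f with same-base e f
  ... | inj₁ refl        = same
  ... | inj₂ (inj₁ refl) = trans (⟨opp⟩ (p ▷ e ▷ opp e) e) (trans (cong ℤ.-_ same) (sym (⟨opp⟩ p e)))
  ... | inj₂ (inj₂ u≢v)  = trans (▷-other (p ▷ e) (opp e) f u≢v) (▷-other p e f u≢v)

▷-cancel : (p : Point n) (e f : Signed n) → p ▷ e ▷ f ▷ opp e ≡ p ▷ f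
▷-cancel p e f = trans (cong (_▷ opp e) (▷-comm p e f)) (▷-inverse (p ▷ f) e)

▷-nonincreasing : (p : Point n) (e f : Signed n) → f ≢ e → (p ▷ e) ⟨ f ⟩ ℤ.≤ p ⟨ f ⟩
▷-nonincreasing p e f f≢e with same-base e f
... | inj₁ f≡e         = contradiction f≡e f≢e
... | inj₂ (inj₁ refl) = ℤ.≤-trans (ℤ.≤-reflexive (▷-opp p e)) (ℤ.i≤j⇒pred[i]≤j ℤ.≤-refl)
... | inj₂ (inj₂ u≢v)  = ℤ.≤-reflexive (▷-other p e f u≢v)

▷-nondecreasing : (p : Point n) (e f : Signed n) → f ≢ opp e → p ⟨ f ⟩ ℤ.≤ (p ▷ e) ⟨ f ⟩
▷-nondecreasing p e f f≢ē with same-base e f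
... | inj₁ refl        = ℤ.≤-trans (ℤ.i≤suc[i] _) (ℤ.≤-reflexive (sym (▷-same p e)))
... | inj₂ (inj₁ f≡ē)  = contradiction f≡ē f≢ē
... | inj₂ (inj₂ u≢v)  = ℤ.≤-reflexive (sym (▷-other p e f u≢v))

▷-≤suc : (p : Point n) (e f : Signed n) → (p ▷ e) ⟨ f ⟩ ℤ.≤ 1ℤ ℤ.+ p ⟨ f ⟩
▷-≤suc p e f with same-base e f
... | inj₁ refl        = ℤ.≤-reflexive (▷-same p e)
... | inj₂ (inj₁ refl) = ℤ.≤-trans (ℤ.≤-reflexive (▷-opp p e)) (ℤ.i≤j⇒pred[i]≤j (ℤ.i≤suc[i] (p ⟨ opp e ⟩)))
... | inj₂ (inj₂ u≢v)  = ℤ.≤-trans (ℤ.≤-reflexive (▷-other p e f u≢v)) (ℤ.i≤suc[i] _)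

toward? : (p q : Point n) (e : Signed n) → Dec (Toward p q e)
toward? p q e = map′ toward gap> (p ⟨ e ⟩ ℤ.<? q ⟨ e ⟩)

¬Toward : {p q : Point n} {e : Signed n} → ¬ Toward p q e → q ⟨ e ⟩ ℤ.≤ p ⟨ e ⟩
¬Toward ¬t = ℤ.≮⇒≥ (¬t ∘ toward)

Toward-irrefl : {p : Point n} {e : Signed n} → ¬ Toward p p e
Toward-irrefl (toward t) = ℤ.<-irrefl refl t

Toward-opp : {p q : Point n} {e : Signed n} → Toward p q e → Toward q p (opp e)
Toward-opp {p = p} {q} {e} (toward t) =
  toward (subst₂ ℤ._<_ (sym (⟨opp⟩ q e)) (sym (⟨opp⟩ p e)) (ℤ.neg-mono-< t))

Toward-opp⁻ : {p q : Point n} {e : Signed n} → Toward p q (opp e) → Toward q p e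
Toward-opp⁻ {p = p} {q} {e} t = subst (Toward q p) (opp-involutive e) (Toward-opp t)

Toward-asym : {p q : Point n} {e : Signed n} → Toward p q e → ¬ Toward p q (opp e)
Toward-asym t t′ = ℤ.<-asym (gap> t) (gap> (Toward-opp⁻ t′))

Toward-base : {p q : Point n} {e f : Signed n} → Toward p q e → Toward p q f → f ≢ e → proj₁ e ≢ proj₁ f
Toward-base {e = e} {f} te tf f≢e with same-base e f
... | inj₁ f≡e         = contradiction f≡e f≢e
... | inj₂ (inj₁ refl) = contradiction tf (Toward-asym te)
... | inj₂ (inj₂ u≢v)  = u≢v

Toward-≢ : {p q : Point n} (u : Fin n) → lookup p u ≢ lookup q u → ∃[ s ] Toward p q (u , s)
Toward-≢ {p = p} {q} u p≢q with lookup p u ℤ.<? lookup q u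
... | yes p<q = Sign.+ , toward p<q
... | no  p≮q = Sign.- , toward (ℤ.neg-mono-< (ℤ.≤∧≢⇒< (ℤ.≮⇒≥ p≮q) (p≢q ∘ sym)))

Toward⇒≢ : {p q : Point n} {e : Signed n} → Toward p q e → lookup p (proj₁ e) ≢ lookup q (proj₁ e)
Toward⇒≢ {e = u , Sign.+} (toward t) p≡q = ℤ.<⇒≢ t p≡q
Toward⇒≢ {e = u , Sign.-} (toward t) p≡q = ℤ.<⇒≢ t (cong ℤ.-_ p≡q)

Toward-▷ : {p q : Point n} (e : Signed n) {f : Signed n} → proj₁ e ≢ proj₁ f → Toward p q f → Toward (p ▷ e) q f
Toward-▷ {p = p} {q} e {f} u≢v (toward t) = toward (subst (ℤ._< q ⟨ f ⟩) (sym (▷-other p e f u≢v)) t)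

Toward-▷⁻ : {p q : Point n} (e : Signed n) {f : Signed n} → proj₁ e ≢ proj₁ f → Toward (p ▷ e) q f → Toward p q f
Toward-▷⁻ {p = p} {q} e {f} u≢v (toward t) = toward (subst (ℤ._< q ⟨ f ⟩) (▷-other p e f u≢v) t)

-- One step of `q` along `e` raises no coordinate except along `e`, and there it cannot pass `p`, as
-- an integer gap is at least one. Pulling `q` towards `p` thus creates no new directions from `p`.
Toward-shrink : {p q : Point n} {e f : Signed n} → Toward q p e → Toward p (q ▷ e) f → Toward p q f
Toward-shrink {p = p} {q} {e} {f} (toward t) (toward tf) with f ≟ₛ e
... | no f≢e   = toward (ℤ.<-≤-trans tf (▷-nonincreasing q e f f≢e))
... | yes refl = contradiction
  (ℤ.<-≤-trans tf (ℤ.≤-trans (ℤ.≤-reflexive (▷-same q e)) (ℤ.i<j⇒suc[i]≤j t)))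
  (ℤ.<-irrefl refl)

▷*-nonincreasing : (p : Point n) (es : List (Signed n)) (f : Signed n) → ¬ (f ∈ˡ es) → (p ▷* es) ⟨ f ⟩ ℤ.≤ p ⟨ f ⟩
▷*-nonincreasing p [] f _ = ℤ.≤-refl
▷*-nonincreasing p (e ∷ es) f f∉ =
  ℤ.≤-trans (▷*-nonincreasing (p ▷ e) es f (f∉ ∘ there)) (▷-nonincreasing p e f (f∉ ∘ here))

▷*-nondecreasing : (p : Point n) (es : List (Signed n)) (f : Signed n) → All (λ e → f ≢ opp e) es → p ⟨ f ⟩ ℤ.≤ (p ▷* es) ⟨ f ⟩
▷*-nondecreasing p [] f _ = ℤ.≤-refl
▷*-nondecreasing p (e ∷ es) f (f≢ ∷ fs) =
  ℤ.≤-trans (▷-nondecreasing p e f f≢) (▷*-nondecreasing (p ▷ e) es f fs)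

-- Distances

dist : Point n → Point n → ℕ
dist p q = ‖ q ⊖ p ‖₁

-- Each distance is paired with the other point's contribution at `u`, which avoids truncated
-- subtraction.
dist-updateAt : (p q : Point n) (u : Fin n) (f : ℤ → ℤ) →
  dist (p [ u ]%= f) q ℕ.+ ∣ lookup q u ℤ.- lookup p u ∣ ≡ dist p q ℕ.+ ∣ lookup q u ℤ.- f (lookup p u) ∣
dist-updateAt (a ∷ p) (b ∷ q) zero f = begin
  (∣ b ℤ.- f a ∣ ℕ.+ dist p q) ℕ.+ ∣ b ℤ.- a ∣   ≡⟨ ℕ.+-comm _ ∣ b ℤ.- a ∣ ⟩
  ∣ b ℤ.- a ∣ ℕ.+ (∣ b ℤ.- f a ∣ ℕ.+ dist p q)   ≡⟨ cong (∣ b ℤ.- a ∣ ℕ.+_) (ℕ.+-comm _ (dist p q)) ⟩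
  ∣ b ℤ.- a ∣ ℕ.+ (dist p q ℕ.+ ∣ b ℤ.- f a ∣)   ≡⟨ ℕ.+-assoc ∣ b ℤ.- a ∣ _ _ ⟨
  (∣ b ℤ.- a ∣ ℕ.+ dist p q) ℕ.+ ∣ b ℤ.- f a ∣   ∎
  where open ≡-Reasoning
dist-updateAt (a ∷ p) (b ∷ q) (suc u) f =
  trans (ℕ.+-assoc ∣ b ℤ.- a ∣ _ _)
    (trans (cong (∣ b ℤ.- a ∣ ℕ.+_) (dist-updateAt p q u f)) (sym (ℕ.+-assoc ∣ b ℤ.- a ∣ _ _)))

dist-▷ : (p q : Point n) (u : Fin n) (s : Sign) →
  dist (p ▷ (u , s)) q ℕ.+ ∣ lookup q u ℤ.- lookup p u ∣ ≡ dist p q ℕ.+ ∣ lookup q u ℤ.- (lookup p u ℤ.+ (s ◃ 1)) ∣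
dist-▷ p q u s = trans (cong (λ r → dist r q ℕ.+ _) (▷-updateAt p u s)) (dist-updateAt p q u _)

∣i-1∣-pos : ∀ i → 0ℤ ℤ.< i → suc ∣ i ℤ.- 1ℤ ∣ ≡ ∣ i ∣
∣i-1∣-pos +[1+ n ] _ = refl
∣i-1∣-pos (+ 0) (+<+ ())

∣i-1∣-nonpos : ∀ i → i ℤ.≤ 0ℤ → ∣ i ℤ.- 1ℤ ∣ ≡ suc ∣ i ∣
∣i-1∣-nonpos (+ 0) _ = refl
∣i-1∣-nonpos +[1+ n ] (+≤+ ())
∣i-1∣-nonpos -[1+ n ] _ = cong (λ k → suc (suc k)) (ℕ.+-identityʳ n)

gap : (p q : Point n) (e : Signed n) → ∣ lookup q (proj₁ e) ℤ.- lookup p (proj₁ e) ∣ ≡ ∣ q ⟨ e ⟩ ℤ.- p ⟨ e ⟩ ∣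
gap p q (u , Sign.+) = refl
gap p q (u , Sign.-) = trans (sym (ℤ.∣-i∣≡∣i∣ (lookup q u ℤ.- lookup p u)))
  (cong ∣_∣ (ℤ.neg-distrib-+ (lookup q u) (ℤ.- lookup p u)))

dist-gap : (p q : Point n) (e : Signed n) →
  dist (p ▷ e) q ℕ.+ ∣ q ⟨ e ⟩ ℤ.- p ⟨ e ⟩ ∣ ≡ dist p q ℕ.+ ∣ (q ⟨ e ⟩ ℤ.- p ⟨ e ⟩) ℤ.- 1ℤ ∣
dist-gap p q e@(u , s) = begin
  dist (p ▷ e) q ℕ.+ ∣ q ⟨ e ⟩ ℤ.- p ⟨ e ⟩ ∣                  ≡⟨ cong (dist (p ▷ e) q ℕ.+_) (gap p q e) ⟨
  dist (p ▷ e) q ℕ.+ ∣ lookup q u ℤ.- lookup p u ∣            ≡⟨ dist-▷ p q u s ⟩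
  dist p q ℕ.+ ∣ lookup q u ℤ.- (lookup p u ℤ.+ (s ◃ 1)) ∣    ≡⟨ cong (λ z → dist p q ℕ.+ ∣ lookup q u ℤ.- z ∣) (lookup-▷ p u s) ⟨
  dist p q ℕ.+ ∣ lookup q u ℤ.- lookup (p ▷ e) u ∣            ≡⟨ cong (dist p q ℕ.+_) (gap (p ▷ e) q e) ⟩
  dist p q ℕ.+ ∣ q ⟨ e ⟩ ℤ.- (p ▷ e) ⟨ e ⟩ ∣                  ≡⟨ cong (λ z → dist p q ℕ.+ ∣ q ⟨ e ⟩ ℤ.- z ∣) (▷-same p e) ⟩
  dist p q ℕ.+ ∣ q ⟨ e ⟩ ℤ.- (1ℤ ℤ.+ p ⟨ e ⟩) ∣               ≡⟨ cong (λ z → dist p q ℕ.+ ∣ z ∣) (lemma (q ⟨ e ⟩) (p ⟨ e ⟩)) ⟩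
  dist p q ℕ.+ ∣ (q ⟨ e ⟩ ℤ.- p ⟨ e ⟩) ℤ.- 1ℤ ∣               ∎
  where
  open ≡-Reasoning
  lemma : ∀ a b → a ℤ.- (1ℤ ℤ.+ b) ≡ (a ℤ.- b) ℤ.- 1ℤ
  lemma = solve-∀

dist-toward : (p q : Point n) (e : Signed n) → Toward p q e → suc (dist (p ▷ e) q) ≡ dist p q
dist-toward p q e (toward t) = ℕ.+-cancelʳ-≡ k _ _ (begin
  suc (dist (p ▷ e) q) ℕ.+ k   ≡⟨ ℕ.+-suc (dist (p ▷ e) q) k ⟨
  dist (p ▷ e) q ℕ.+ suc k     ≡⟨ cong (dist (p ▷ e) q ℕ.+_) (∣i-1∣-pos (q ⟨ e ⟩ ℤ.- p ⟨ e ⟩) (subst (ℤ._< q ⟨ e ⟩ ℤ.- p ⟨ e ⟩) (ℤ.+-inverseʳ (p ⟨ e ⟩)) (ℤ.+-monoˡ-< (ℤ.- p ⟨ e ⟩) t))) ⟩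
  dist (p ▷ e) q ℕ.+ _         ≡⟨ dist-gap p q e ⟩
  dist p q ℕ.+ k               ∎)
  where
  open ≡-Reasoning
  k = ∣ (q ⟨ e ⟩ ℤ.- p ⟨ e ⟩) ℤ.- 1ℤ ∣

dist-away : (p q : Point n) (e : Signed n) → ¬ Toward p q e → dist (p ▷ e) q ≡ suc (dist p q)
dist-away p q e ¬t = ℕ.+-cancelʳ-≡ k _ _ (begin
  dist (p ▷ e) q ℕ.+ k         ≡⟨ dist-gap p q e ⟩
  dist p q ℕ.+ _               ≡⟨ cong (dist p q ℕ.+_) (∣i-1∣-nonpos _ (ℤ.i≤j⇒i-j≤0 (¬Toward ¬t))) ⟩
  dist p q ℕ.+ suc k           ≡⟨ ℕ.+-suc (dist p q) k ⟩
  suc (dist p q ℕ.+ k)         ∎)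
  where
  open ≡-Reasoning
  k = ∣ q ⟨ e ⟩ ℤ.- p ⟨ e ⟩ ∣

dist-≤suc : (p q : Point n) (e : Signed n) → dist (p ▷ e) q ℕ.≤ suc (dist p q)
dist-≤suc p q e with toward? p q e
... | yes t = ℕ.≤-trans (ℕ.n≤1+n _) (ℕ.≤-trans (ℕ.≤-reflexive (dist-toward p q e t)) (ℕ.n≤1+n _))
... | no ¬t = ℕ.≤-reflexive (dist-away p q e ¬t)

dist-toward-< : (p q : Point n) (e : Signed n) → Toward p q e → dist (p ▷ e) q ℕ.< dist p q
dist-toward-< p q e t = ℕ.≤-reflexive (dist-toward p q e t)

dist-toward₂ : (p q : Point n) (e f : Signed n) → Toward p q e → Toward p q f → f ≢ e →
  suc (suc (dist (p ▷ e ▷ f) q)) ≡ dist p q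
dist-toward₂ p q e f te tf f≢e =
  trans (cong suc (dist-toward (p ▷ e) q f (Toward-▷ e (Toward-base te tf f≢e) tf)))
    (dist-toward p q e te)

-- The exchange property in terms of signed elements

-- Δ-EXC with steps taken one at a time: `e` is the element to be covered and the second step is
-- optional. Two different directions towards `q` never share a coordinate, so `f ≢ e` suffices for
-- the pair to lie in Φ.
Exchange : Pred (Point n) ℓ → Set ℓ
Exchange B = ∀ p q → p ∈ B → q ∈ B → ∀ e → Toward p q e →
  (p ▷ e) ∈ B ⊎ ∃[ f ] f ≢ e × Toward p q f × (p ▷ e ▷ f) ∈ B

0ᵖ : Point n
0ᵖ {n} = replicate n 0ℤ

⊕-identityˡ : (p : Point n) → 0ᵖ ⊕ p ≡ p
⊕-identityˡ = Vec.zipWith-identityˡ ℤ.+-identityˡ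

χ-as-▷ : (e : Signed n) → proj₂ e ·χ proj₁ e ≡ 0ᵖ ▷ e
χ-as-▷ e = sym (⊕-identityˡ _)

lookup-χ : (s : Sign) (u : Fin n) → lookup (s ·χ u) u ≡ s ◃ 1
lookup-χ s u = begin
  lookup (s ·χ u) u             ≡⟨ cong (λ r → lookup r u) (χ-as-▷ (u , s)) ⟩
  lookup (0ᵖ ▷ (u , s)) u       ≡⟨ lookup-▷ 0ᵖ u s ⟩
  lookup 0ᵖ u ℤ.+ (s ◃ 1)       ≡⟨ cong (ℤ._+ (s ◃ 1)) (Vec.lookup-replicate u 0ℤ) ⟩
  0ℤ ℤ.+ (s ◃ 1)                ≡⟨ ℤ.+-identityˡ _ ⟩
  s ◃ 1                         ∎
  where open ≡-Reasoning

lookup-χ-≢ : (s : Sign) (u v : Fin n) → u ≢ v → lookup (s ·χ u) v ≡ 0ℤ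
lookup-χ-≢ s u v u≢v = begin
  lookup (s ·χ u) v             ≡⟨ cong (λ r → lookup r v) (χ-as-▷ (u , s)) ⟩
  lookup (0ᵖ ▷ (u , s)) v       ≡⟨ lookup-▷-≢ 0ᵖ u v s u≢v ⟩
  lookup 0ᵖ v                   ≡⟨ Vec.lookup-replicate v 0ℤ ⟩
  0ℤ                            ∎
  where open ≡-Reasoning

‖0‖₁ : ∀ n → ‖ 0ᵖ {n} ‖₁ ≡ 0
‖0‖₁ zero    = refl
‖0‖₁ (suc n) = ‖0‖₁ n

‖‖₁-as-dist : (p : Point n) → ‖ p ‖₁ ≡ dist p 0ᵖ
‖‖₁-as-dist [] = refl
‖‖₁-as-dist (a ∷ p) = cong₂ ℕ._+_
  (trans (sym (ℤ.∣-i∣≡∣i∣ a)) (cong ∣_∣ (sym (ℤ.+-identityˡ (ℤ.- a))))) (‖‖₁-as-dist p)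

‖χ‖₁ : (s : Sign) (u : Fin n) → ‖ s ·χ u ‖₁ ≡ 1
‖χ‖₁ {n} s u = begin
  ‖ s ·χ u ‖₁                ≡⟨ ‖‖₁-as-dist (s ·χ u) ⟩
  dist (s ·χ u) 0ᵖ           ≡⟨ cong (λ r → dist r 0ᵖ) (χ-as-▷ (u , s)) ⟩
  dist (0ᵖ ▷ (u , s)) 0ᵖ     ≡⟨ dist-away 0ᵖ 0ᵖ (u , s) Toward-irrefl ⟩
  suc (dist (0ᵖ {n}) 0ᵖ)     ≡⟨ cong suc (trans (sym (‖‖₁-as-dist (0ᵖ {n}))) (‖0‖₁ n)) ⟩
  1                          ∎
  where open ≡-Reasoning

‖χ⊕χ‖₁ : (e f : Signed n) → proj₁ e ≢ proj₁ f → ‖ proj₂ e ·χ proj₁ e ⊕ proj₂ f ·χ proj₁ f ‖₁ ≡ 2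
‖χ⊕χ‖₁ {n} e f u≢v = begin
  ‖ proj₂ e ·χ proj₁ e ▷ f ‖₁   ≡⟨ ‖‖₁-as-dist (proj₂ e ·χ proj₁ e ▷ f) ⟩
  dist (proj₂ e ·χ proj₁ e ▷ f) 0ᵖ    ≡⟨ cong (λ r → dist (r ▷ f) 0ᵖ) (χ-as-▷ e) ⟩
  dist (0ᵖ ▷ e ▷ f) 0ᵖ          ≡⟨ dist-away (0ᵖ ▷ e) 0ᵖ f (Toward-irrefl ∘ Toward-▷⁻ e u≢v) ⟩
  suc (dist (0ᵖ ▷ e) 0ᵖ)        ≡⟨ cong (λ r → suc (dist r 0ᵖ)) (χ-as-▷ e) ⟨
  suc (dist (proj₂ e ·χ proj₁ e) 0ᵖ)  ≡⟨ cong suc (‖‖₁-as-dist (proj₂ e ·χ proj₁ e)) ⟨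
  suc ‖ proj₂ e ·χ proj₁ e ‖₁   ≡⟨ cong suc (‖χ‖₁ (proj₂ e) (proj₁ e)) ⟩
  2                             ∎
  where open ≡-Reasoning

Φ-toward : Point n → Point n → Point n → Set
Φ-toward p q α =
    (∃[ e ] Toward p q e × α ≡ proj₂ e ·χ proj₁ e)
  ⊎ (∃[ e ] ∃[ f ] f ≢ e × Toward p q e × Toward p q f × α ≡ proj₂ e ·χ proj₁ e ⊕ proj₂ f ·χ proj₁ f)

i+[j-i]≡j : ∀ i j → i ℤ.+ (j ℤ.- i) ≡ j
i+[j-i]≡j = solve-∀

+-≡⇒-≡ : ∀ k {a b : ℕ} → k ℕ.+ a ≡ b → + a ≡ + b ℤ.- + k
+-≡⇒-≡ k {a} refl = sym (begin
  + (k ℕ.+ a) ℤ.- + k      ≡⟨ cong (ℤ._- + k) (ℤ.pos-+ k a) ⟩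
  + k ℤ.+ + a ℤ.- + k      ≡⟨ lemma (+ k) (+ a) ⟩
  + a                      ∎)
  where
  open ≡-Reasoning
  lemma : ∀ i j → i ℤ.+ j ℤ.- i ≡ j
  lemma = solve-∀

-≡⇒+-≡ : ∀ k {a b : ℕ} → + a ≡ + b ℤ.- + k → k ℕ.+ a ≡ b
-≡⇒+-≡ k {a} {b} eq = ℤ.+-injective (begin
  + (k ℕ.+ a)                ≡⟨ ℤ.pos-+ k a ⟩
  + k ℤ.+ + a                ≡⟨ cong (ℤ._+_ (+ k)) eq ⟩
  + k ℤ.+ (+ b ℤ.- + k)      ≡⟨ i+[j-i]≡j (+ k) (+ b) ⟩
  + b                        ∎)
  where open ≡-Reasoning

▷-pair : (p : Point n) (e f : Signed n) → p ⊕ (proj₂ e ·χ proj₁ e ⊕ proj₂ f ·χ proj₁ f) ≡ p ▷ e ▷ f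
▷-pair p e f = sym (⊕-assoc p _ _)

Φ-toward⇒Φ : {p q α : Point n} → Φ-toward p q α → α ∈ Φ⟨ p , q ⟩
Φ-toward⇒Φ {p = p} {q} (inj₁ (e@(u , s) , t , refl)) = inj₁ (s , u , refl) , +-≡⇒-≡ ‖ s ·χ u ‖₁
  (trans (cong (ℕ._+ dist (p ▷ e) q) (‖χ‖₁ s u)) (dist-toward p q e t))
Φ-toward⇒Φ {p = p} {q} (inj₂ (e@(u , s) , f@(v , s′) , f≢e , te , tf , refl)) =
  inj₂ (s , s′ , u , v , u≢v , refl) , +-≡⇒-≡ ‖ s ·χ u ⊕ s′ ·χ v ‖₁
  (trans (cong₂ ℕ._+_ (‖χ⊕χ‖₁ e f u≢v) (cong (λ r → dist r q) (▷-pair p e f)))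
    (dist-toward₂ p q e f te tf f≢e))
  where u≢v = Toward-base te tf f≢e

-- A single step changes the distance to `q` by exactly one, down if it is directed towards `q` and
-- up otherwise. A move of norm k that saves k therefore consists of directed steps only.
Φ⇒Φ-toward : {p q α : Point n} → α ∈ Φ⟨ p , q ⟩ → Φ-toward p q α
Φ⇒Φ-toward {p = p} {q} (inj₁ (s , u , refl) , eq) with toward? p q (u , s)
... | yes t = inj₁ ((u , s) , t , refl)
... | no ¬t = contradiction (begin-strict
  dist p q                               <⟨ ℕ.n<1+n _ ⟩
  suc (dist p q)                         ≡⟨ dist-away p q (u , s) ¬t ⟨
  dist (p ▷ (u , s)) q                   ≤⟨ ℕ.m≤n+m _ ‖ s ·χ u ‖₁ ⟩
  ‖ s ·χ u ‖₁ ℕ.+ dist (p ▷ (u , s)) q   ≡⟨ -≡⇒+-≡ ‖ s ·χ u ‖₁ eq ⟩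
  dist p q                               ∎) (ℕ.<-irrefl refl)
  where open ℕ.≤-Reasoning
Φ⇒Φ-toward {p = p} {q} (inj₂ (s , s′ , u , v , u≢v , refl) , eq)
  with toward? p q (u , s) | toward? (p ▷ (u , s)) q (v , s′)
     -- The norm equation in additive form: two plus the distance after both steps is the distance
     -- before.
     | trans (cong₂ ℕ._+_ (sym (‖χ⊕χ‖₁ (u , s) (v , s′) u≢v)) (cong (λ r → dist r q) (sym (▷-pair p (u , s) (v , s′)))))
         (-≡⇒+-≡ ‖ s ·χ u ⊕ s′ ·χ v ‖₁ eq)
... | yes te | yes tf | _ =
  inj₂ ((u , s) , (v , s′) , (λ eq → u≢v (sym (cong proj₁ eq))) , te , Toward-▷⁻ (u , s) u≢v tf , refl)
... | yes te | no ¬tf | eq′ = contradiction (begin-strict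
  dist p q                                      ≡⟨ dist-toward p q (u , s) te ⟨
  suc (dist (p ▷ (u , s)) q)                    ≡⟨ dist-away (p ▷ (u , s)) q (v , s′) ¬tf ⟨
  dist (p ▷ (u , s) ▷ (v , s′)) q               <⟨ ℕ.m<n+m _ ℕ.z<s ⟩
  2 ℕ.+ dist (p ▷ (u , s) ▷ (v , s′)) q         ≡⟨ eq′ ⟩
  dist p q                                      ∎) (ℕ.<-irrefl refl)
  where open ℕ.≤-Reasoning
... | no ¬te | tf? | eq′ = contradiction (begin-strict
  dist p q                                      <⟨ ℕ.n<1+n _ ⟩
  suc (dist p q)                                ≡⟨ dist-away p q (u , s) ¬te ⟨
  dist (p ▷ (u , s)) q                          ≤⟨ lower-bound tf? ⟩
  suc (dist (p ▷ (u , s) ▷ (v , s′)) q)         ≤⟨ ℕ.n≤1+n _ ⟩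
  2 ℕ.+ dist (p ▷ (u , s) ▷ (v , s′)) q         ≡⟨ eq′ ⟩
  dist p q                                      ∎) (ℕ.<-irrefl refl)
  where
  open ℕ.≤-Reasoning
  lower-bound : Dec (Toward (p ▷ (u , s)) q (v , s′)) →
    dist (p ▷ (u , s)) q ℕ.≤ suc (dist (p ▷ (u , s) ▷ (v , s′)) q)
  lower-bound (yes tf) = ℕ.≤-reflexive (sym (dist-toward (p ▷ (u , s)) q (v , s′) tf))
  lower-bound (no ¬tf) = ℕ.≤-trans (ℕ.n≤1+n _)
    (ℕ.≤-trans (ℕ.≤-reflexive (sym (dist-away (p ▷ (u , s)) q (v , s′) ¬tf))) (ℕ.n≤1+n _))

lookup-⊖ : (p q : Point n) (u : Fin n) → lookup (q ⊖ p) u ≡ lookup q u ℤ.- lookup p u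
lookup-⊖ p q u = Vec.lookup-zipWith ℤ._-_ u q p

Toward⇒supp : {p q : Point n} {e : Signed n} → Toward p q e → proj₁ e ∈ supp (q ⊖ p)
Toward⇒supp {p = p} {q} {u , _} t q-p≡0 =
  Toward⇒≢ t (sym (ℤ.i-j≡0⇒i≡j _ _ (trans (sym (lookup-⊖ p q u)) q-p≡0)))

supp⇒Toward : {p q : Point n} {u : Fin n} → u ∈ supp (q ⊖ p) → ∃[ s ] Toward p q (u , s)
supp⇒Toward {p = p} {q} {u} u∈ =
  Toward-≢ u λ p≡q → u∈ (trans (lookup-⊖ p q u) (ℤ.i≡j⇒i-j≡0 (sym p≡q)))

Toward-unique : {p q : Point n} {e f : Signed n} → Toward p q e → Toward p q f → proj₁ f ≡ proj₁ e → f ≡ e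
Toward-unique {e = e} {f} te tf eq with f ≟ₛ e
... | yes f≡e = f≡e
... | no  f≢e = contradiction (sym eq) (Toward-base te tf f≢e)

-- Since `α` is nonzero at `u`, one of its steps has base `u`, and `Toward-unique` identifies that
-- step with `e`.
Δ-EXC⇒Exchange : {B : Pred (Point n) ℓ} → Δ-EXC B → Exchange B
Δ-EXC⇒Exchange {B = B} ex p q p∈B q∈B e@(u , s) te with ex p q p∈B q∈B u (Toward⇒supp te)
... | α , (α∈Φ , α∈B) , u∈α with Φ⇒Φ-toward α∈Φ
... | inj₁ (f@(v , s′) , tf , refl) with v Fin.≟ u
...   | no v≢u  = contradiction (lookup-χ-≢ s′ v u v≢u) u∈α
...   | yes v≡u = inj₁ (subst (λ g → (p ▷ g) ∈ B) (Toward-unique te tf v≡u) α∈B)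
Δ-EXC⇒Exchange {B = B} ex p q p∈B q∈B e@(u , s) te
    | α , (α∈Φ , α∈B) , u∈α | inj₂ (f@(v , s₁) , g@(w , s₂) , g≢f , tf , tg , refl) with v Fin.≟ u | w Fin.≟ u
...   | yes v≡u | _ = inj₂ (g , (λ g≡e → g≢f (trans g≡e (sym f≡e))) , tg ,
        subst (λ h → (p ▷ h ▷ g) ∈ B) f≡e (subst B (▷-pair p f g) α∈B))
  where f≡e = Toward-unique te tf v≡u
...   | no v≢u | yes w≡u = inj₂ (f , (λ f≡e → v≢u (cong proj₁ f≡e)) , tf ,
        subst (λ h → (p ▷ h ▷ f) ∈ B) (Toward-unique te tg w≡u)
          (subst B (trans (▷-pair p f g) (▷-comm p f g)) α∈B))
...   | no v≢u | no w≢u = contradiction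
        (trans (Vec.lookup-zipWith ℤ._+_ u (s₁ ·χ v) (s₂ ·χ w))
          (cong₂ ℤ._+_ (lookup-χ-≢ s₁ v u v≢u) (lookup-χ-≢ s₂ w u w≢u))) u∈α

sign◃1≢0 : ∀ s → s ◃ 1 ≢ 0ℤ
sign◃1≢0 Sign.+ ()
sign◃1≢0 Sign.- ()

Exchange⇒Δ-EXC : {B : Pred (Point n) ℓ} → Exchange B → Δ-EXC B
Exchange⇒Δ-EXC {B = B} ex p q p∈B q∈B u u∈ with supp⇒Toward {p = p} {q} u∈
... | s , te with ex p q p∈B q∈B (u , s) te
... | inj₁ in-B = s ·χ u , (Φ-toward⇒Φ (inj₁ ((u , s) , te , refl)) , in-B) ,
        λ eq → sign◃1≢0 s (trans (sym (lookup-χ s u)) eq)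
... | inj₂ (f@(v , s′) , f≢e , tf , in-B) =
  s ·χ u ⊕ s′ ·χ v ,
  (Φ-toward⇒Φ (inj₂ ((u , s) , f , f≢e , te , tf , refl)) , subst B (sym (▷-pair p (u , s) f)) in-B) ,
  λ eq → sign◃1≢0 s (trans (sym (trans (lookup-▷-≢ (s ·χ u) v u s′ (Toward-base te tf f≢e ∘ sym)) (lookup-χ s u))) eq)

-- Linear functionals

negₜ : Trit → Trit
negₜ -1ₜ = 1ₜ
negₜ 0ₜ  = 0ₜ
negₜ 1ₜ  = -1ₜ

infix 4 _≟ₜ_
infix 9 _⟦_⟧

_⟦_⟧ : Vec Trit n → Signed n → Trit
x ⟦ u , Sign.+ ⟧ = lookup x u
x ⟦ u , Sign.- ⟧ = negₜ (lookup x u)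

negₜ-involutive : ∀ t → negₜ (negₜ t) ≡ t
negₜ-involutive -1ₜ = refl
negₜ-involutive 0ₜ  = refl
negₜ-involutive 1ₜ  = refl

⟦opp⟧ : (x : Vec Trit n) (e : Signed n) → x ⟦ opp e ⟧ ≡ negₜ (x ⟦ e ⟧)
⟦opp⟧ x (u , Sign.+) = refl
⟦opp⟧ x (u , Sign.-) = sym (negₜ-involutive _)

⟪⟫-updateAt : (p : Point n) (x : Vec Trit n) (u : Fin n) (c : ℤ) →
  ⟪ p [ u ]%= (ℤ._+ c) , x ⟫ ≡ ⟪ p , x ⟫ ℤ.+ c ℤ.* tritToℤ (lookup x u)
⟪⟫-updateAt (a ∷ p) (t ∷ x) zero c = lemma a c (tritToℤ t) ⟪ p , x ⟫
  where
  lemma : ∀ a c t r → (a ℤ.+ c) ℤ.* t ℤ.+ r ≡ a ℤ.* t ℤ.+ r ℤ.+ c ℤ.* t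
  lemma = solve-∀
⟪⟫-updateAt (a ∷ p) (t ∷ x) (suc u) c =
  trans (cong (ℤ._+_ (a ℤ.* tritToℤ t)) (⟪⟫-updateAt p x u c)) (sym (ℤ.+-assoc (a ℤ.* tritToℤ t) ⟪ p , x ⟫ _))

⟪⟫-▷ : (p : Point n) (x : Vec Trit n) (e : Signed n) → ⟪ p ▷ e , x ⟫ ≡ ⟪ p , x ⟫ ℤ.+ tritToℤ (x ⟦ e ⟧)
⟪⟫-▷ p x e@(u , s) = begin
  ⟪ p ▷ e , x ⟫                                    ≡⟨ cong ⟪_, x ⟫ (▷-updateAt p u s) ⟩
  ⟪ p [ u ]%= (ℤ._+ (s ◃ 1)) , x ⟫                 ≡⟨ ⟪⟫-updateAt p x u (s ◃ 1) ⟩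
  ⟪ p , x ⟫ ℤ.+ (s ◃ 1) ℤ.* tritToℤ (lookup x u)   ≡⟨ cong (ℤ._+_ ⟪ p , x ⟫) (signed s (lookup x u) refl) ⟩
  ⟪ p , x ⟫ ℤ.+ tritToℤ (x ⟦ e ⟧)                  ∎
  where
  open ≡-Reasoning
  signed : ∀ s t → lookup x u ≡ t → (s ◃ 1) ℤ.* tritToℤ t ≡ tritToℤ (x ⟦ u , s ⟧)
  signed Sign.+ t   refl = ℤ.*-identityˡ (tritToℤ t)
  signed Sign.- -1ₜ eq rewrite eq = refl
  signed Sign.- 0ₜ  eq rewrite eq = refl
  signed Sign.- 1ₜ  eq rewrite eq = refl

⟪⟫-mono-terms : (p q : Point n) (x : Vec Trit n) →
  (∀ u → lookup p u ℤ.* tritToℤ (lookup x u) ℤ.≤ lookup q u ℤ.* tritToℤ (lookup x u)) → ⟪ p , x ⟫ ℤ.≤ ⟪ q , x ⟫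
⟪⟫-mono-terms [] [] [] _ = ℤ.≤-refl
⟪⟫-mono-terms (a ∷ p) (b ∷ q) (t ∷ x) le = ℤ.+-mono-≤ (le zero) (⟪⟫-mono-terms p q x (le ∘ suc))

-- A coordinate where `x` is -1 is read along its negative element, where the value is 1;
-- coordinates where `x` is 0 contribute nothing.
⟪⟫-mono : (p q : Point n) (x : Vec Trit n) → (∀ e → x ⟦ e ⟧ ≡ 1ₜ → p ⟨ e ⟩ ℤ.≤ q ⟨ e ⟩) → ⟪ p , x ⟫ ℤ.≤ ⟪ q , x ⟫
⟪⟫-mono p q x le = ⟪⟫-mono-terms p q x λ u → term u (lookup x u) refl
  where
  i*-1 : ∀ i → i ℤ.* -1ℤ ≡ ℤ.- i
  i*-1 = solve-∀
  term : ∀ u t → lookup x u ≡ t → lookup p u ℤ.* tritToℤ (lookup x u) ℤ.≤ lookup q u ℤ.* tritToℤ (lookup x u)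
  term u -1ₜ eq rewrite eq | i*-1 (lookup p u) | i*-1 (lookup q u) = le (u , Sign.-) (cong negₜ eq)
  term u 0ₜ eq rewrite eq | ℤ.*-zeroʳ (lookup p u) | ℤ.*-zeroʳ (lookup q u) = ℤ.≤-refl
  term u 1ₜ eq rewrite eq | ℤ.*-identityʳ (lookup p u) | ℤ.*-identityʳ (lookup q u) = le (u , Sign.+) eq

_≟ₜ_ : (s t : Trit) → Dec (s ≡ t)
-1ₜ ≟ₜ -1ₜ = yes refl
-1ₜ ≟ₜ 0ₜ  = no λ ()
-1ₜ ≟ₜ 1ₜ  = no λ ()
0ₜ  ≟ₜ -1ₜ = no λ ()
0ₜ  ≟ₜ 0ₜ  = yes refl
0ₜ  ≟ₜ 1ₜ  = no λ ()
1ₜ  ≟ₜ -1ₜ = no λ ()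
1ₜ  ≟ₜ 0ₜ  = no λ ()
1ₜ  ≟ₜ 1ₜ  = yes refl

any-signed? : {P : Signed n → Set ℓ} → (∀ e → Dec (P e)) → Dec (∃[ e ] P e)
any-signed? P? = map′
  (λ { (u , inj₁ P+) → (u , Sign.+) , P+ ; (u , inj₂ P-) → (u , Sign.-) , P- })
  (λ { ((u , Sign.+) , P+) → u , inj₁ P+ ; ((u , Sign.-) , P-) → u , inj₂ P- })
  (Fin.any? λ u → P? (u , Sign.+) ⊎-dec P? (u , Sign.-))

-- If no element valued 1 by `x` were directed from `p` to `q`, `⟪⟫-mono` would give the reverse
-- inequality.
improving : (x : Vec Trit n) {p q : Point n} → ⟪ p , x ⟫ ℤ.< ⟪ q , x ⟫ → ∃[ e ] x ⟦ e ⟧ ≡ 1ₜ × Toward p q e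
improving x {p} {q} lt with any-signed? (λ e → (x ⟦ e ⟧ ≟ₜ 1ₜ) ×-dec toward? p q e)
... | yes found = found
... | no  none  = contradiction (ℤ.<-≤-trans lt (⟪⟫-mono q p x λ e xe → ¬Toward λ t → none (e , xe , t))) (ℤ.<-irrefl refl)

-1≤tritToℤ : ∀ t → -1ℤ ℤ.≤ tritToℤ t
-1≤tritToℤ -1ₜ = -≤- ℕ.z≤n
-1≤tritToℤ 0ₜ  = -≤+
-1≤tritToℤ 1ₜ  = -≤+

⟪⟫-▷-1 : (p : Point n) (x : Vec Trit n) (e : Signed n) → x ⟦ e ⟧ ≡ 1ₜ → ⟪ p ▷ e , x ⟫ ≡ 1ℤ ℤ.+ ⟪ p , x ⟫
⟪⟫-▷-1 p x e xe = trans (⟪⟫-▷ p x e) (trans (cong (λ t → ⟪ p , x ⟫ ℤ.+ tritToℤ t) xe) (ℤ.+-comm ⟪ p , x ⟫ 1ℤ))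

⟪⟫-▷-≤ : (p : Point n) (x : Vec Trit n) (e : Signed n) → x ⟦ e ⟧ ≡ 1ₜ → ⟪ p , x ⟫ ℤ.≤ ⟪ p ▷ e , x ⟫
⟪⟫-▷-≤ p x e xe = ℤ.≤-trans (ℤ.i≤suc[i] ⟪ p , x ⟫) (ℤ.≤-reflexive (sym (⟪⟫-▷-1 p x e xe)))

-- The gain of one along `e` pays for the loss along `f`, which is at most one.
⟪⟫-▷▷-≤ : (p : Point n) (x : Vec Trit n) (e : Signed n) (f : Signed n) → x ⟦ e ⟧ ≡ 1ₜ → ⟪ p , x ⟫ ℤ.≤ ⟪ p ▷ e ▷ f , x ⟫
⟪⟫-▷▷-≤ p x e f xe = begin
  ⟪ p , x ⟫                                        ≡⟨ lemma ⟪ p , x ⟫ ⟩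
  1ℤ ℤ.+ ⟪ p , x ⟫ ℤ.+ -1ℤ                         ≤⟨ ℤ.+-monoʳ-≤ (1ℤ ℤ.+ ⟪ p , x ⟫) (-1≤tritToℤ (x ⟦ f ⟧)) ⟩
  1ℤ ℤ.+ ⟪ p , x ⟫ ℤ.+ tritToℤ (x ⟦ f ⟧)           ≡⟨ cong (ℤ._+ tritToℤ (x ⟦ f ⟧)) (⟪⟫-▷-1 p x e xe) ⟨
  ⟪ p ▷ e , x ⟫ ℤ.+ tritToℤ (x ⟦ f ⟧)              ≡⟨ ⟪⟫-▷ (p ▷ e) x f ⟨
  ⟪ p ▷ e ▷ f , x ⟫                                ∎
  where
  open ℤ.≤-Reasoning
  lemma : ∀ i → i ≡ 1ℤ ℤ.+ i ℤ.+ -1ℤ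
  lemma = solve-∀

-- Pull q towards p along directions that increase x; once there are none left,
-- any remaining gain of q over p already shows in a move from p.
local⇒global : {B : Pred (Point n) ℓ} → Exchange B → (x : Vec Trit n) →
  ∀ k {p q} → dist q p ℕ.< k → p ∈ B → q ∈ B →
  (∀ {e} → Toward p q e → x ⟦ e ⟧ ≡ 1ₜ → (p ▷ e) ∉ B) →
  (∀ {e f} → Toward p q e → Toward p q f → f ≢ e → x ⟦ e ⟧ ≡ 1ₜ → x ⟦ f ⟧ ≢ -1ₜ → (p ▷ e ▷ f) ∉ B) →
  ⟪ q , x ⟫ ℤ.≤ ⟪ p , x ⟫
local⇒global ex x (suc k) {p} {q} (ℕ.s≤s d≤k) p∈B q∈B loc₁ loc₂
  with any-signed? (λ e → (x ⟦ e ⟧ ≟ₜ 1ₜ) ×-dec toward? q p e)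
... | yes (e , xe , te) with ex q p q∈B p∈B e te
...   | inj₁ in-B = ℤ.≤-trans (⟪⟫-▷-≤ q x e xe)
  (local⇒global ex x k (ℕ.<-≤-trans (dist-toward-< q p e te) d≤k) p∈B in-B
    (loc₁ ∘ Toward-shrink te) (λ t t′ → loc₂ (Toward-shrink te t) (Toward-shrink te t′)))
...   | inj₂ (f , f≢e , tf , in-B) = ℤ.≤-trans (⟪⟫-▷▷-≤ q x e f xe)
  (local⇒global ex x k (ℕ.<-≤-trans (ℕ.<-trans (dist-toward-< (q ▷ e) p f tf′) (dist-toward-< q p e te)) d≤k) p∈B in-B
    (loc₁ ∘ shrink) (λ t t′ → loc₂ (shrink t) (shrink t′)))
  where
  tf′ : Toward (q ▷ e) p f
  tf′ = Toward-▷ e (Toward-base te tf f≢e) tf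
  -- Directions from `p` to the pulled point are already directions from `p` to `q`, so both local
  -- hypotheses carry over.
  shrink : ∀ {g} → Toward p (q ▷ e ▷ f) g → Toward p q g
  shrink = Toward-shrink te ∘ Toward-shrink tf′
local⇒global ex x (suc k) {p} {q} (ℕ.s≤s d≤k) p∈B q∈B loc₁ loc₂
    | no none with ⟪ q , x ⟫ ℤ.≤? ⟪ p , x ⟫
...   | yes le = le
...   | no ¬le with improving x (ℤ.≰⇒> ¬le)
...   | e , xe , te with ex p q p∈B q∈B e te
...   | inj₁ in-B = contradiction in-B (loc₁ te xe)
-- If `x` were -1 at `f`, then `opp f` would be a direction from `q` to `p` valued 1, and those are
-- exhausted.
...   | inj₂ (f , f≢e , tf , in-B) = contradiction in-B (loc₂ te tf f≢e xe
  λ xf → none (opp f , trans (⟦opp⟧ x f) (cong negₜ xf) , Toward-opp tf))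

-- If x ⊑ y then every move of q towards p that increases x does not decrease y.
common-maximiser : {B : Pred (Point n) ℓ} → Exchange B → (x y : Vec Trit n) →
  (∀ e → x ⟦ e ⟧ ≡ 1ₜ → y ⟦ e ⟧ ≡ 1ₜ) → ∀ k {p q} → dist q p ℕ.< k → p ∈ B → q ∈ B →
  ∃[ r ] r ∈ B × ⟪ p , x ⟫ ℤ.≤ ⟪ r , x ⟫ × ⟪ q , y ⟫ ℤ.≤ ⟪ r , y ⟫
common-maximiser ex x y x⊑y (suc k) {p} {q} (ℕ.s≤s d≤k) p∈B q∈B with ⟪ p , x ⟫ ℤ.≤? ⟪ q , x ⟫
... | yes le = q , q∈B , le , ℤ.≤-refl
... | no ¬le with improving x (ℤ.≰⇒> ¬le)
... | e , xe , te with ex q p q∈B p∈B e te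
... | inj₁ in-B =
  let r , r∈B , ≤r , ≤r′ = common-maximiser ex x y x⊑y k (ℕ.<-≤-trans (dist-toward-< q p e te) d≤k) p∈B in-B
  in r , r∈B , ≤r , ℤ.≤-trans (⟪⟫-▷-≤ q y e (x⊑y e xe)) ≤r′
... | inj₂ (f , f≢e , tf , in-B) =
  let tf′ = Toward-▷ e (Toward-base te tf f≢e) tf
      d<k = ℕ.<-≤-trans (ℕ.<-trans (dist-toward-< (q ▷ e) p f tf′) (dist-toward-< q p e te)) d≤k
      r , r∈B , ≤r , ≤r′ = common-maximiser ex x y x⊑y k d<k p∈B in-B
  in r , r∈B , ≤r , ℤ.≤-trans (⟪⟫-▷▷-≤ q y e f (x⊑y e xe)) ≤r′

-- BS-convex sets satisfy the exchange property

+-cancelˡ-≤ : ∀ k {i j} → k ℤ.+ i ℤ.≤ k ℤ.+ j → i ℤ.≤ j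
+-cancelˡ-≤ k {i} {j} le = subst₂ ℤ._≤_ (cancel k i) (cancel k j) (ℤ.+-monoʳ-≤ (ℤ.- k) le)
  where
  cancel : ∀ k i → ℤ.- k ℤ.+ (k ℤ.+ i) ≡ i
  cancel = solve-∀

negₜ-⊓ : ∀ s t → negₜ (s ⊓ t) ≡ negₜ s ⊓ negₜ t
negₜ-⊓ -1ₜ -1ₜ = refl
negₜ-⊓ -1ₜ 0ₜ  = refl
negₜ-⊓ -1ₜ 1ₜ  = refl
negₜ-⊓ 0ₜ  t   = refl
negₜ-⊓ 1ₜ  -1ₜ = refl
negₜ-⊓ 1ₜ  0ₜ  = refl
negₜ-⊓ 1ₜ  1ₜ  = refl

negₜ-⊔ : ∀ s t → negₜ (s ⊔ t) ≡ negₜ s ⊔ negₜ t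
negₜ-⊔ -1ₜ -1ₜ = refl
negₜ-⊔ -1ₜ 0ₜ  = refl
negₜ-⊔ -1ₜ 1ₜ  = refl
negₜ-⊔ 0ₜ  t   = refl
negₜ-⊔ 1ₜ  -1ₜ = refl
negₜ-⊔ 1ₜ  0ₜ  = refl
negₜ-⊔ 1ₜ  1ₜ  = refl

⟦⟧-⊓ : (x y : Vec Trit n) (e : Signed n) → (x ⊓ᵛ y) ⟦ e ⟧ ≡ x ⟦ e ⟧ ⊓ y ⟦ e ⟧
⟦⟧-⊓ x y (u , Sign.+) = Vec.lookup-zipWith _⊓_ u x y
⟦⟧-⊓ x y (u , Sign.-) = trans (cong negₜ (Vec.lookup-zipWith _⊓_ u x y)) (negₜ-⊓ (lookup x u) (lookup y u))

⟦⟧-⊔ : (x y : Vec Trit n) (e : Signed n) → (x ⊔ᵛ y) ⟦ e ⟧ ≡ x ⟦ e ⟧ ⊔ y ⟦ e ⟧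
⟦⟧-⊔ x y (u , Sign.+) = Vec.lookup-zipWith _⊔_ u x y
⟦⟧-⊔ x y (u , Sign.-) = trans (cong negₜ (Vec.lookup-zipWith _⊔_ u x y)) (negₜ-⊔ (lookup x u) (lookup y u))

⊓⊔-modular : ∀ s t → tritToℤ (s ⊓ t) ℤ.+ tritToℤ (s ⊔ t) ≡ tritToℤ s ℤ.+ tritToℤ t
⊓⊔-modular -1ₜ -1ₜ = refl
⊓⊔-modular -1ₜ 0ₜ  = refl
⊓⊔-modular -1ₜ 1ₜ  = refl
⊓⊔-modular 0ₜ  t   = refl
⊓⊔-modular 1ₜ  -1ₜ = refl
⊓⊔-modular 1ₜ  0ₜ  = refl
⊓⊔-modular 1ₜ  1ₜ  = refl

⟪⟫-modular : (p : Point n) (x y : Vec Trit n) → ⟪ p , x ⊓ᵛ y ⟫ ℤ.+ ⟪ p , x ⊔ᵛ y ⟫ ≡ ⟪ p , x ⟫ ℤ.+ ⟪ p , y ⟫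
⟪⟫-modular [] [] [] = refl
⟪⟫-modular (a ∷ p) (s ∷ x) (t ∷ y) = begin
  (a ℤ.* tritToℤ (s ⊓ t) ℤ.+ ⟪ p , x ⊓ᵛ y ⟫) ℤ.+ (a ℤ.* tritToℤ (s ⊔ t) ℤ.+ ⟪ p , x ⊔ᵛ y ⟫)
    ≡⟨ shuffle a (tritToℤ (s ⊓ t)) (tritToℤ (s ⊔ t)) ⟪ p , x ⊓ᵛ y ⟫ ⟪ p , x ⊔ᵛ y ⟫ ⟩
  a ℤ.* (tritToℤ (s ⊓ t) ℤ.+ tritToℤ (s ⊔ t)) ℤ.+ (⟪ p , x ⊓ᵛ y ⟫ ℤ.+ ⟪ p , x ⊔ᵛ y ⟫)
    ≡⟨ cong₂ (λ i j → a ℤ.* i ℤ.+ j) (⊓⊔-modular s t) (⟪⟫-modular p x y) ⟩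
  a ℤ.* (tritToℤ s ℤ.+ tritToℤ t) ℤ.+ (⟪ p , x ⟫ ℤ.+ ⟪ p , y ⟫)
    ≡⟨ shuffle a (tritToℤ s) (tritToℤ t) ⟪ p , x ⟫ ⟪ p , y ⟫ ⟨
  (a ℤ.* tritToℤ s ℤ.+ ⟪ p , x ⟫) ℤ.+ (a ℤ.* tritToℤ t ℤ.+ ⟪ p , y ⟫) ∎
  where
  open ≡-Reasoning
  shuffle : ∀ a s t i j → (a ℤ.* s ℤ.+ i) ℤ.+ (a ℤ.* t ℤ.+ j) ≡ a ℤ.* (s ℤ.+ t) ℤ.+ (i ℤ.+ j)
  shuffle = solve-∀

∣_∣ₜ : Trit → ℕ
∣ -1ₜ ∣ₜ = 1
∣ 0ₜ  ∣ₜ = 0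
∣ 1ₜ  ∣ₜ = 1

size : Vec Trit n → ℕ
size x = Vec.sum (Vec.map ∣_∣ₜ x)

∣⊓∣ₜ-≤ : ∀ s t → ∣ s ⊓ t ∣ₜ ℕ.≤ ∣ s ∣ₜ
∣⊓∣ₜ-≤ -1ₜ -1ₜ = ℕ.≤-refl
∣⊓∣ₜ-≤ -1ₜ 0ₜ  = ℕ.z≤n
∣⊓∣ₜ-≤ -1ₜ 1ₜ  = ℕ.z≤n
∣⊓∣ₜ-≤ 0ₜ  t   = ℕ.≤-refl
∣⊓∣ₜ-≤ 1ₜ  -1ₜ = ℕ.z≤n
∣⊓∣ₜ-≤ 1ₜ  0ₜ  = ℕ.z≤n
∣⊓∣ₜ-≤ 1ₜ  1ₜ  = ℕ.≤-refl

∣⊓∣ₜ-< : ∀ s t → s ≢ 0ₜ → t ≢ s → ∣ s ⊓ t ∣ₜ ℕ.< ∣ s ∣ₜ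
∣⊓∣ₜ-< -1ₜ -1ₜ _ t≢s = contradiction refl t≢s
∣⊓∣ₜ-< -1ₜ 0ₜ  _ _ = ℕ.s≤s ℕ.z≤n
∣⊓∣ₜ-< -1ₜ 1ₜ  _ _ = ℕ.s≤s ℕ.z≤n
∣⊓∣ₜ-< 0ₜ  t   s≢0 _ = contradiction refl s≢0
∣⊓∣ₜ-< 1ₜ  -1ₜ _ _ = ℕ.s≤s ℕ.z≤n
∣⊓∣ₜ-< 1ₜ  0ₜ  _ _ = ℕ.s≤s ℕ.z≤n
∣⊓∣ₜ-< 1ₜ  1ₜ  _ t≢s = contradiction refl t≢s

size-⊓-≤ : (x y : Vec Trit n) → size (x ⊓ᵛ y) ℕ.≤ size x
size-⊓-≤ [] [] = ℕ.≤-refl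
size-⊓-≤ (s ∷ x) (t ∷ y) = ℕ.+-mono-≤ (∣⊓∣ₜ-≤ s t) (size-⊓-≤ x y)

size-⊓-< : (x y : Vec Trit n) (u : Fin n) → lookup x u ≢ 0ₜ → lookup y u ≢ lookup x u → size (x ⊓ᵛ y) ℕ.< size x
size-⊓-< (s ∷ x) (t ∷ y) zero    s≢0 t≢s = ℕ.+-mono-<-≤ (∣⊓∣ₜ-< s t s≢0 t≢s) (size-⊓-≤ x y)
size-⊓-< (s ∷ x) (t ∷ y) (suc u) s≢0 t≢s = ℕ.+-mono-≤-< (∣⊓∣ₜ-≤ s t) (size-⊓-< x y u s≢0 t≢s)

⟦⟧-cong : (x y : Vec Trit n) (e : Signed n) → lookup x (proj₁ e) ≡ lookup y (proj₁ e) → x ⟦ e ⟧ ≡ y ⟦ e ⟧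
⟦⟧-cong x y (u , Sign.+) eq = eq
⟦⟧-cong x y (u , Sign.-) eq = cong negₜ eq

⟦⟧-lookup≢0 : (x : Vec Trit n) (e : Signed n) → x ⟦ e ⟧ ≡ 1ₜ → lookup x (proj₁ e) ≢ 0ₜ
⟦⟧-lookup≢0 x (u , Sign.+) xe eq with trans (sym xe) eq
... | ()
⟦⟧-lookup≢0 x (u , Sign.-) xe eq with trans (sym xe) (cong negₜ eq)
... | ()

module BisubmodularExchange (em₀ : ExcludedMiddle 0ℓ) (f : Vec Trit n → ℤ ⁺) (bs : IsIntegralBisubmodular f) where

  open IsIntegralBisubmodular bs

  -- Asserting a slack also asserts that `f x` is finite; slack 0 means that the constraint `x` is
  -- tight at `p`.
  Slack : Point n → Vec Trit n → ℕ → Set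
  Slack p x k = f x ≡ [ ⟪ p , x ⟫ ℤ.+ + k ]

  slack : (p : Point n) (x : Vec Trit n) → [ ⟪ p , x ⟫ ] ≤⁺ f x → f x ≡ ⊤⁺ ⊎ ∃[ k ] Slack p x k
  slack p x le with f x
  slack p x (_ ≤⊤⁺) | _ = inj₁ refl
  slack p x (≤[_] {l = l} le) | _ = inj₂ (∣ l ℤ.- ⟪ p , x ⟫ ∣ , cong [_] (sym (begin
    ⟪ p , x ⟫ ℤ.+ + ∣ l ℤ.- ⟪ p , x ⟫ ∣   ≡⟨ cong (ℤ._+_ ⟪ p , x ⟫) (ℤ.0≤i⇒+∣i∣≡i (ℤ.i≤j⇒0≤j-i le)) ⟩
    ⟪ p , x ⟫ ℤ.+ (l ℤ.- ⟪ p , x ⟫)       ≡⟨ i+[j-i]≡j ⟪ p , x ⟫ l ⟩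
    l                                     ∎)))
    where open ≡-Reasoning

  -- Subtract the equation `⟪⟫-modular` from the bisubmodular inequality. Its larger side is finite,
  -- which excludes `⊤⁺` at the meet and the join. Slacks 0 and 0 give closure of the tight vectors
  -- under both.
  uncross : ∀ p → p ∈ Pℤ f → ∀ {x y k l} → Slack p x k → Slack p y l →
    ∃[ i ] ∃[ j ] Slack p (x ⊓ᵛ y) i × Slack p (x ⊔ᵛ y) j × i ℕ.+ j ℕ.≤ k ℕ.+ l
  uncross p p∈P {x} {y} {k} {l} sx sy
    with bisubmodular x y | slack p (x ⊓ᵛ y) (p∈P (x ⊓ᵛ y)) | slack p (x ⊔ᵛ y) (p∈P (x ⊔ᵛ y))
  ... | le | s⊓ | s⊔ rewrite sx | sy with s⊓ | s⊔
  ... | inj₁ ⊓≡⊤ | _ rewrite ⊓≡⊤ = case le of λ ()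
  ... | inj₂ (i , s⊓′) | inj₁ ⊔≡⊤ rewrite s⊓′ | ⊔≡⊤ = case le of λ ()
  ... | inj₂ (i , s⊓′) | inj₂ (j , s⊔′) rewrite s⊓′ | s⊔′ =
    i , j , refl , refl , ℤ.drop‿+≤+ (+-cancelˡ-≤ (⟪ p , x ⟫ ℤ.+ ⟪ p , y ⟫) (begin
      (⟪ p , x ⟫ ℤ.+ ⟪ p , y ⟫) ℤ.+ + (i ℕ.+ j)
        ≡⟨ cong₂ ℤ._+_ (sym (⟪⟫-modular p x y)) (ℤ.pos-+ i j) ⟩
      (⟪ p , x ⊓ᵛ y ⟫ ℤ.+ ⟪ p , x ⊔ᵛ y ⟫) ℤ.+ (+ i ℤ.+ + j)
        ≡⟨ shuffle ⟪ p , x ⊓ᵛ y ⟫ ⟪ p , x ⊔ᵛ y ⟫ (+ i) (+ j) ⟩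
      (⟪ p , x ⊓ᵛ y ⟫ ℤ.+ + i) ℤ.+ (⟪ p , x ⊔ᵛ y ⟫ ℤ.+ + j)
        ≤⟨ [≤]-injective le ⟩
      (⟪ p , x ⟫ ℤ.+ + k) ℤ.+ (⟪ p , y ⟫ ℤ.+ + l)
        ≡⟨ shuffle ⟪ p , x ⟫ ⟪ p , y ⟫ (+ k) (+ l) ⟨
      (⟪ p , x ⟫ ℤ.+ ⟪ p , y ⟫) ℤ.+ (+ k ℤ.+ + l)
        ≡⟨ cong (ℤ._+_ (⟪ p , x ⟫ ℤ.+ ⟪ p , y ⟫)) (ℤ.pos-+ k l) ⟨
      (⟪ p , x ⟫ ℤ.+ ⟪ p , y ⟫) ℤ.+ + (k ℕ.+ l) ∎))
    where
    open ℤ.≤-Reasoning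
    shuffle : ∀ a b c d → (a ℤ.+ b) ℤ.+ (c ℤ.+ d) ≡ (a ℤ.+ c) ℤ.+ (b ℤ.+ d)
    shuffle = solve-∀

  -- A unit step raises each constraint by at most one, so it can only break a tight one with value
  -- 1 at `e`.
  move₁ : ∀ p e → p ∈ Pℤ f → (∀ x → x ⟦ e ⟧ ≡ 1ₜ → ¬ Slack p x 0) → (p ▷ e) ∈ Pℤ f
  move₁ p e p∈P free x with slack p x (p∈P x)
  ... | inj₁ fx≡⊤ rewrite fx≡⊤ = _ ≤⊤⁺
  ... | inj₂ (k , sk) rewrite sk | ⟪⟫-▷ p x e =
    ≤[ ℤ.+-monoʳ-≤ ⟪ p , x ⟫ (bound (x ⟦ e ⟧) k λ { xe refl → free x xe sk }) ]
    where
    bound : ∀ t k → (t ≡ 1ₜ → k ≢ 0) → tritToℤ t ℤ.≤ + k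
    bound -1ₜ k       _    = -≤+
    bound 0ₜ  k       _    = +≤+ ℕ.z≤n
    bound 1ₜ  zero    free = contradiction refl (free refl)
    bound 1ₜ  (suc k) _    = +≤+ (ℕ.s≤s ℕ.z≤n)

  -- Least among the tight vectors valued 1 at `e`, in the order where D ⊑ x if `x` is 1 on every
  -- signed element on which `D` is 1.
  Minimal : Point n → Signed n → Vec Trit n → Set
  Minimal p e D = D ⟦ e ⟧ ≡ 1ₜ × Slack p D 0 ×
    (∀ x → x ⟦ e ⟧ ≡ 1ₜ → Slack p x 0 → ∀ g → D ⟦ g ⟧ ≡ 1ₜ → x ⟦ g ⟧ ≡ 1ₜ)

  -- Meeting `D` with a tight vector that disagrees with it somewhere on its support keeps tightness
  -- and the value 1 at `e`, while the support shrinks; `k` bounds its size.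
  minimal : ∀ p e → p ∈ Pℤ f → ∀ k D → size D ℕ.< k → D ⟦ e ⟧ ≡ 1ₜ → Slack p D 0 → ∃[ D ] Minimal p e D
  minimal p e p∈P (suc k) D (ℕ.s≤s D≤k) De sD
    with em₀ {∃[ x ] x ⟦ e ⟧ ≡ 1ₜ × Slack p x 0 × (∃[ g ] D ⟦ g ⟧ ≡ 1ₜ × x ⟦ g ⟧ ≢ 1ₜ)}
  ... | no none = D , De , sD , λ x xe sx g Dg → decidable-stable (x ⟦ g ⟧ ≟ₜ 1ₜ) λ xg → none (x , xe , sx , g , Dg , xg)
  ... | yes (x , xe , sx , g , Dg , xg) with uncross p p∈P {D} {x} {0} {0} sD sx
  -- The two slacks add up to at most 0, so the meet is tight.
  ... | zero , _ , s⊓ , _ = minimal p e p∈P k (D ⊓ᵛ x)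
        (ℕ.<-≤-trans (size-⊓-< D x (proj₁ g) (⟦⟧-lookup≢0 D g Dg) λ eq → xg (trans (⟦⟧-cong x D g eq) Dg)) D≤k)
        (trans (⟦⟧-⊓ D x e) (cong₂ _⊓_ De xe)) s⊓

  exchange : Exchange (Pℤ f)
  exchange p q p∈P q∈P e te with em₀ {∃[ x ] x ⟦ e ⟧ ≡ 1ₜ × Slack p x 0}
  ... | no none = inj₁ (move₁ p e p∈P λ x xe sx → none (x , xe , sx))
  ... | yes (x , xe , sx) with minimal p e p∈P _ x ℕ.≤-refl xe sx
  -- As ⟨q, D⟩ ≤ f(D) = ⟨p, D⟩ < ⟨p ▷ e, D⟩, some `g` valued 1 by `D` is directed from `q` to
  -- `p ▷ e`; its opposite is the second step.
  ... | D , De , sD , least with improving D {q} {p ▷ e} q<p▷e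
    where
    q≤p : ⟪ q , D ⟫ ℤ.≤ ⟪ p , D ⟫
    q≤p with q∈P D
    ... | le rewrite sD | ℤ.+-identityʳ ⟪ p , D ⟫ = [≤]-injective le
    q<p▷e : ⟪ q , D ⟫ ℤ.< ⟪ p ▷ e , D ⟫
    q<p▷e = ℤ.suc[i]≤j⇒i<j (ℤ.≤-trans (ℤ.+-monoʳ-≤ 1ℤ q≤p) (ℤ.≤-reflexive (sym (⟪⟫-▷-1 p D e De))))
  ... | g , Dg , tg = inj₂ (opp g , ḡ≢e , Toward-opp (Toward-shrink te tg) , p▷e▷ḡ∈P)
    where
    ḡ≢e : opp g ≢ e
    ḡ≢e eq with trans (sym De) (trans (cong (D ⟦_⟧) (sym eq)) (trans (⟦opp⟧ D g) (cong negₜ Dg)))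
    ... | ()
    clash : ∀ y → y ⟦ e ⟧ ≡ 1ₜ → y ⟦ g ⟧ ≢ 1ₜ → ¬ Slack p y 0
    clash y ye yg sy = yg (least y ye sy g Dg)
    -- Where `y` is -1 at `g`, its join and its meet with `D` are 0 there. If they keep the value 1
    -- at `e`, their tightness would contradict the minimality of `D`.
    ⊔-clash : ∀ y t → y ⟦ e ⟧ ≡ t → t ≢ -1ₜ → y ⟦ g ⟧ ≡ -1ₜ → ¬ Slack p (D ⊔ᵛ y) 0
    ⊔-clash y t ye t≢-1 yg = clash (D ⊔ᵛ y) (trans (⟦⟧-⊔ D y e) (trans (cong₂ _⊔_ De ye) (1⊔ t t≢-1)))
      λ eq → case trans (sym (trans (⟦⟧-⊔ D y g) (cong₂ _⊔_ Dg yg))) eq of λ ()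
      where
      1⊔ : ∀ t → t ≢ -1ₜ → 1ₜ ⊔ t ≡ 1ₜ
      1⊔ -1ₜ t≢-1 = contradiction refl t≢-1
      1⊔ 0ₜ  _    = refl
      1⊔ 1ₜ  _    = refl
    ⊓-clash : ∀ y → y ⟦ e ⟧ ≡ 1ₜ → y ⟦ g ⟧ ≡ -1ₜ → ¬ Slack p (D ⊓ᵛ y) 0
    ⊓-clash y ye yg = clash (D ⊓ᵛ y) (trans (⟦⟧-⊓ D y e) (cong₂ _⊓_ De ye))
      λ eq → case trans (sym (trans (⟦⟧-⊓ D y g) (cong₂ _⊓_ Dg yg))) eq of λ ()
    -- The two steps change ⟨p, y⟩ by y(e) - y(g), to be compared with the slack of `y`. The change
    -- is positive only for the value pairs (0, -1), (1, 0) and (1, -1).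
    bound : ∀ y k s t → y ⟦ e ⟧ ≡ s → y ⟦ g ⟧ ≡ t → Slack p y k → tritToℤ s ℤ.+ tritToℤ (negₜ t) ℤ.≤ + k
    bound y k       -1ₜ -1ₜ ye yg sy = +≤+ ℕ.z≤n
    bound y k       -1ₜ 0ₜ  ye yg sy = -≤+
    bound y k       -1ₜ 1ₜ  ye yg sy = -≤+
    bound y k       0ₜ  0ₜ  ye yg sy = +≤+ ℕ.z≤n
    bound y k       0ₜ  1ₜ  ye yg sy = -≤+
    bound y k       1ₜ  1ₜ  ye yg sy = +≤+ ℕ.z≤n
    bound y zero    0ₜ  -1ₜ ye yg sy with uncross p p∈P {D} {y} {0} {0} sD sy
    ... | zero , zero , _ , s⊔ , _ = contradiction s⊔ (⊔-clash y 0ₜ ye (λ ()) yg)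
    bound y (suc k) 0ₜ  -1ₜ ye yg sy = +≤+ (ℕ.s≤s ℕ.z≤n)
    bound y zero    1ₜ  0ₜ  ye yg sy = contradiction sy (clash y ye λ eq → case trans (sym yg) eq of λ ())
    bound y (suc k) 1ₜ  0ₜ  ye yg sy = +≤+ (ℕ.s≤s ℕ.z≤n)
    bound y zero    1ₜ  -1ₜ ye yg sy = contradiction sy (clash y ye λ eq → case trans (sym yg) eq of λ ())
    -- A change of 2 against slack 1: the slacks of the meet and the join with `D` add up to at most
    -- 1, so one of the two would be tight.
    bound y 1       1ₜ  -1ₜ ye yg sy with uncross p p∈P {D} {y} {0} {1} sD sy
    ... | zero , _ , s⊓ , _ , _ = contradiction s⊓ (⊓-clash y ye yg)
    ... | suc i , zero , _ , s⊔ , _ = contradiction s⊔ (⊔-clash y 1ₜ ye (λ ()) yg)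
    ... | suc i , suc j , _ , _ , ℕ.s≤s le = contradiction (ℕ.≤-trans (ℕ.m≤n+m (suc j) i) le) λ ()
    bound y (suc (suc k)) 1ₜ -1ₜ ye yg sy = +≤+ (ℕ.s≤s (ℕ.s≤s ℕ.z≤n))
    p▷e▷ḡ∈P : (p ▷ e ▷ opp g) ∈ Pℤ f
    p▷e▷ḡ∈P y with slack p y (p∈P y)
    ... | inj₁ fy≡⊤ rewrite fy≡⊤ = _ ≤⊤⁺
    ... | inj₂ (k , sk) rewrite sk | ⟪⟫-▷ (p ▷ e) y (opp g) | ⟪⟫-▷ p y e | ⟦opp⟧ y g
                              | ℤ.+-assoc ⟪ p , y ⟫ (tritToℤ (y ⟦ e ⟧)) (tritToℤ (negₜ (y ⟦ g ⟧))) =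
      ≤[ ℤ.+-monoʳ-≤ ⟪ p , y ⟫ (bound y k (y ⟦ e ⟧) (y ⟦ g ⟧) refl refl sk) ]

Exchange-≐ : {B : Pred (Point n) ℓ} {C : Pred (Point n) 0ℓ} → B ≐ C → Exchange C → Exchange B
Exchange-≐ (B⊆C , C⊆B) ex p q p∈B q∈B e te with ex p q (B⊆C p∈B) (B⊆C q∈B) e te
... | inj₁ in-C                    = inj₁ (C⊆B in-C)
... | inj₂ (f , f≢e , tf , in-C) = inj₂ (f , f≢e , tf , C⊆B in-C)

-- Sets with the exchange property are BS-convex

▷-inverse′ : (p : Point n) (e : Signed n) → p ▷ opp e ▷ e ≡ p
▷-inverse′ p e = trans (▷-comm p (opp e) e) (▷-inverse p e)

▷-cancel′ : (p : Point n) (e f : Signed n) → p ▷ opp e ▷ f ▷ e ≡ p ▷ f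
▷-cancel′ p e f = trans (cong (_▷ e) (▷-comm p (opp e) f)) (▷-inverse′ (p ▷ f) e)

▷-cancel₂ : (p : Point n) (e f g : Signed n) → p ▷ e ▷ f ▷ g ▷ opp e ≡ p ▷ g ▷ f
▷-cancel₂ p e f g = trans (▷-comm (p ▷ e ▷ f) g (opp e)) (trans (cong (_▷ g) (▷-cancel p e f)) (▷-comm p f g))

-- The target is given by a path from `r` that starts with `e` and never undoes it, so `e` is
-- directed towards the target. Along an element absent from the path the target is no farther than
-- `r`; the partner of `e` must be on the path, which leaves a short list of cases.
exchange-along : {B : Pred (Point n) ℓ} → Exchange B → ∀ r {r′} e fs → r ∈ B → r′ ∈ B →
  r ▷ e ▷* fs ≡ r′ → All (λ f → e ≢ opp f) fs →
  (r ▷ e) ∈ B ⊎ ∃[ f ] f ∈ˡ fs × f ≢ e × (r ▷ e ▷ f) ∈ B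
exchange-along ex r e fs r∈B r′∈B refl e≢
  with ex r (r ▷ e ▷* fs) r∈B r′∈B e
    (toward (ℤ.suc[i]≤j⇒i<j (ℤ.≤-trans (ℤ.≤-reflexive (sym (▷-same r e))) (▷*-nondecreasing (r ▷ e) fs e e≢))))
... | inj₁ in-B = inj₁ in-B
... | inj₂ (f , f≢e , toward tf , in-B) with Any.any? (f ≟ₛ_) fs
...   | yes f∈fs = inj₂ (f , f∈fs , f≢e , in-B)
...   | no  f∉fs = contradiction
  (ℤ.<-≤-trans tf (ℤ.≤-trans (▷*-nonincreasing (r ▷ e) fs f f∉fs) (▷-nonincreasing r e f f≢e)))
  (ℤ.<-irrefl refl)

closest : ExcludedMiddle ℓ → (B : Pred (Point n) ℓ) (q : Point n) → ∀ k p → dist p q ℕ.< k → p ∈ B →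
  ∃[ p ] p ∈ B × (∀ r → r ∈ B → dist p q ℕ.≤ dist r q)
closest em B q (suc k) p (ℕ.s≤s d≤k) p∈B with em {∃[ r ] r ∈ B × dist r q ℕ.< dist p q}
... | yes (r , r∈B , r<p) = closest em B q k r (ℕ.<-≤-trans r<p d≤k) r∈B
... | no none = p , p∈B , λ r r∈B → ℕ.≮⇒≥ λ r<p → none (r , r∈B , r<p)

-- The separating functional x is 1 on the directions D from p to q, and −1 on
-- each further element that can be added to p together with a member of D.
module Separation (em : ExcludedMiddle ℓ) {B : Pred (Point n) ℓ} (ex : Exchange B)
  {p q : Point n} (p∈B : p ∈ B) (p-closest : ∀ r → r ∈ B → dist p q ℕ.≤ dist r q) where

  D : Signed n → Set
  D = Toward p q

  closer∉ : ∀ r → dist r q ℕ.< dist p q → r ∉ B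
  closer∉ r r<p r∈B = ℕ.<⇒≱ r<p (p-closest r r∈B)

  one∉ : ∀ {e} → D e → (p ▷ e) ∉ B
  one∉ {e} De = closer∉ _ (dist-toward-< p q e De)

  two∉ : ∀ {e f} → D e → D f → f ≢ e → (p ▷ e ▷ f) ∉ B
  two∉ {e} {f} De Df f≢e = closer∉ _ (ℕ.≤-trans (ℕ.n≤1+n _) (ℕ.≤-reflexive (dist-toward₂ p q e f De Df f≢e)))

  -- The first two steps gain two units of distance to `q` and the third loses at most one, so the
  -- point is still closer than `p`.
  three∉ : ∀ {e f} g → D e → D f → f ≢ e → (p ▷ e ▷ f ▷ g) ∉ B
  three∉ {e} {f} g De Df f≢e = closer∉ _ (ℕ.≤-trans (ℕ.s≤s (dist-≤suc (p ▷ e ▷ f) q g))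
    (ℕ.≤-reflexive (dist-toward₂ p q e f De Df f≢e)))

  D-≢ : ∀ {e g} → D e → ¬ D g → e ≢ g
  D-≢ De ¬Dg refl = ¬Dg De

  D-≢-opp-opp : ∀ {e g} → D e → ¬ D g → e ≢ opp (opp g)
  D-≢-opp-opp {g = g} De ¬Dg e≡ = D-≢ De ¬Dg (trans e≡ (opp-involutive g))

  -- Otherwise exchange from `p ▷ e ▷ opp g` along `g`: the result `p ▷ e` is too close to `q`, and
  -- the only partner on the path would be `g` again, which an exchange forbids.
  opposite-∉-same : ∀ {e} g → D e → (p ▷ e ▷ g) ∈ B → (p ▷ e ▷ opp g) ∉ B
  opposite-∉-same {e} g De eg∈ eḡ∈
    with exchange-along ex (p ▷ e ▷ opp g) g (g ∷ []) eḡ∈ eg∈ (cong (_▷ g) (▷-inverse′ (p ▷ e) g)) (e≢opp ∷ [])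
  ... | inj₁ in-B = one∉ De (subst B (▷-inverse′ (p ▷ e) g) in-B)
  ... | inj₂ (_ , here refl , g≢g , _) = g≢g refl

  -- For `f ≢ e`, exchange along `e` from `p ▷ f ▷ opp g` to `p ▷ e ▷ g`. A single step lands in
  -- `three∉`, the partner `opp f` leads to the case of equal directions, and the partner `g` to
  -- `two∉`.
  opposite-∉ : ∀ {e f} g → D e → D f → ¬ D g → ¬ D (opp g) → (p ▷ e ▷ g) ∈ B → (p ▷ f ▷ opp g) ∉ B
  opposite-∉ {e} {f} g De Df ¬Dg ¬Dḡ eg∈ fḡ∈ with f ≟ₛ e
  ... | yes refl = opposite-∉-same g De eg∈ fḡ∈
  ... | no f≢e
    with exchange-along ex (p ▷ f ▷ opp g) e (opp f ∷ g ∷ g ∷ []) fḡ∈ eg∈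
      (trans (cong (λ r → r ▷ g ▷ g) (▷-cancel₂ p f (opp g) e)) (cong (_▷ g) (▷-inverse′ (p ▷ e) g)))
      ((λ e≡ → f≢e (sym (trans e≡ (opp-involutive f)))) ∷ D-≢ De ¬Dḡ ∷ D-≢ De ¬Dḡ ∷ [])
  ...   | inj₁ in-B = three∉ (opp g) Df De (f≢e ∘ sym) (subst B (▷-comm (p ▷ f) (opp g) e) in-B)
  ...   | inj₂ (_ , here refl , _ , in-B) = opposite-∉-same g De eg∈ (subst B (▷-cancel₂ p f (opp g) e) in-B)
  ...   | inj₂ (_ , there (here refl) , _ , in-B) = two∉ Df De (f≢e ∘ sym) (subst B (▷-cancel′ (p ▷ f) g e) in-B)
  ...   | inj₂ (_ , there (there (here refl)) , _ , in-B) = two∉ Df De (f≢e ∘ sym) (subst B (▷-cancel′ (p ▷ f) g e) in-B)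

  -- `g` enters through its opposite: `opp g` can be added together with `e`, so the functional is
  -- to be -1 on `opp g` and 1 on `g`.
  Nbr : Signed n → Set ℓ
  Nbr g = ∃[ e ] D e × (p ▷ e ▷ opp g) ∈ B × ¬ D g × ¬ D (opp g)

  X : Signed n → Set ℓ
  X g = D g ⊎ Nbr g

  -- This makes a ternary vector with value 1 on `X` well defined, so that `trit` may test the
  -- positive sign first.
  X-asym : ∀ {g} → X g → ¬ X (opp g)
  X-asym (inj₁ Dg) (inj₁ Dḡ) = Toward-asym Dg Dḡ
  X-asym {g} (inj₁ Dg) (inj₂ (_ , _ , _ , _ , ¬Dg)) = ¬Dg (subst D (sym (opp-involutive g)) Dg)
  X-asym (inj₂ (_ , _ , _ , _ , ¬Dḡ)) (inj₁ Dḡ) = ¬Dḡ Dḡ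
  X-asym {g} (inj₂ (e , De , eḡ∈ , ¬Dg , ¬Dḡ)) (inj₂ (f , Df , fg∈ , _ , ¬Dḡḡ)) =
    opposite-∉ (opp g) De Df ¬Dḡ ¬Dḡḡ eḡ∈ fg∈

  trit : ∀ {u} → Dec (X (u , Sign.+)) → Dec (X (u , Sign.-)) → Trit
  trit (yes _) _       = 1ₜ
  trit (no _)  (yes _) = -1ₜ
  trit (no _)  (no _)  = 0ₜ

  x : Vec Trit n
  x = tabulate λ u → trit {u} em em

  x⇒X : ∀ {g} → x ⟦ g ⟧ ≡ 1ₜ → X g
  x⇒X {u , Sign.+} xg = sound em em (trans (sym (Vec.lookup∘tabulate _ u)) xg)
    where
    sound : ∀ d+ d- → trit {u} d+ d- ≡ 1ₜ → X (u , Sign.+)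
    sound (yes X+) _ _ = X+
    sound (no _) (yes _) ()
    sound (no _) (no _) ()
  x⇒X {u , Sign.-} xg = sound em em (trans (cong negₜ (sym (Vec.lookup∘tabulate _ u))) xg)
    where
    sound : ∀ d+ d- → negₜ (trit {u} d+ d-) ≡ 1ₜ → X (u , Sign.-)
    sound (yes _) _ ()
    sound (no _) (yes X-) _ = X-
    sound (no _) (no _) ()

  X⇒x : ∀ {g} → X g → x ⟦ g ⟧ ≡ 1ₜ
  X⇒x {u , Sign.+} Xg = trans (Vec.lookup∘tabulate _ u) (complete em em)
    where
    complete : ∀ d+ d- → trit {u} d+ d- ≡ 1ₜ
    complete (yes _) _ = refl
    complete (no ¬X) _ = contradiction Xg ¬X
  X⇒x {u , Sign.-} Xg = trans (cong negₜ (Vec.lookup∘tabulate _ u)) (complete em em)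
    where
    complete : ∀ d+ d- → negₜ (trit {u} d+ d-) ≡ 1ₜ
    complete (yes X+) _       = contradiction Xg (X-asym X+)
    complete (no _)  (yes _) = refl
    complete (no _)  (no ¬X) = contradiction Xg ¬X

  x≢-1⇒¬X-opp : ∀ {g} → x ⟦ g ⟧ ≢ -1ₜ → ¬ X (opp g)
  x≢-1⇒¬X-opp {g} xg Xḡ = xg (begin
    x ⟦ g ⟧               ≡⟨ cong (x ⟦_⟧) (opp-involutive g) ⟨
    x ⟦ opp (opp g) ⟧     ≡⟨ ⟦opp⟧ x (opp g) ⟩
    negₜ (x ⟦ opp g ⟧)    ≡⟨ cong negₜ (X⇒x Xḡ) ⟩
    -1ₜ                   ∎)
    where open ≡-Reasoning

  -- For a neighbour `g` with witness `e`, exchange along `e` from `p ▷ g` towards `p ▷ e ▷ opp g`.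
  -- The step `e` alone contradicts `opposite-∉`, and with partner `opp g` it gives `p ▷ e`, too
  -- close to `q`.
  local₁ : ∀ {g} → X g → (p ▷ g) ∉ B
  local₁ (inj₁ Dg) = one∉ Dg
  local₁ {g} (inj₂ (e , De , eḡ∈ , ¬Dg , ¬Dḡ)) g∈
    with exchange-along ex (p ▷ g) e (opp g ∷ opp g ∷ []) g∈ eḡ∈ (cong (_▷ opp g) (▷-cancel p g e))
      (D-≢-opp-opp De ¬Dg ∷ D-≢-opp-opp De ¬Dg ∷ [])
  ... | inj₁ in-B = opposite-∉ g De De ¬Dg ¬Dḡ (subst B (▷-comm p g e) in-B) eḡ∈
  ... | inj₂ (_ , here refl , _ , in-B) = one∉ De (subst B (▷-cancel p g e) in-B)
  ... | inj₂ (_ , there (here refl) , _ , in-B) = one∉ De (subst B (▷-cancel p g e) in-B)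

  -- Otherwise `h` is exchangeable with `e`, which makes `opp h` a member of `Nbr`.
  ¬X-opp⇒Nbr-free : ∀ {e h} → ¬ X (opp h) → D e → ¬ D h → (p ▷ e ▷ h) ∉ B
  ¬X-opp⇒Nbr-free {e} {h} ¬Xh̄ De ¬Dh eh∈ = ¬Xh̄ (inj₂ (e , De ,
    subst (λ g → (p ▷ e ▷ g) ∈ B) (sym (opp-involutive h)) eh∈ ,
    ¬Xh̄ ∘ inj₁ , ¬Dh ∘ subst D (opp-involutive h)))

  -- A pair with `g` valued 1 increases `x` unless `x` is -1 at `h`, that is, unless `opp h` lies in
  -- `X`. The hard case, a neighbour `g` with witness `e` and `h` outside `D`, exchanges along `e`
  -- towards `p ▷ e ▷ opp g`.
  local₂ : ∀ {g h} → X g → ¬ X (opp h) → proj₁ g ≢ proj₁ h → (p ▷ g ▷ h) ∉ B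
  local₂ {g} {h} (inj₁ Dg) ¬Xh̄ u≢v gh∈ with toward? p q h
  ... | yes Dh = two∉ Dg Dh (λ h≡g → u≢v (cong proj₁ (sym h≡g))) gh∈
  ... | no ¬Dh = ¬X-opp⇒Nbr-free ¬Xh̄ Dg ¬Dh gh∈
  local₂ {g} {h} (inj₂ (e , De , eḡ∈ , ¬Dg , ¬Dḡ)) ¬Xh̄ u≢v gh∈ with toward? p q h
  ... | yes Dh = opposite-∉ g Dh De ¬Dg ¬Dḡ (subst B (▷-comm p g h) gh∈) eḡ∈
  ... | no ¬Dh
    with exchange-along ex (p ▷ g ▷ h) e (opp h ∷ opp g ∷ opp g ∷ []) gh∈ eḡ∈
      (trans (cong (λ r → r ▷ opp g ▷ opp g) (▷-cancel (p ▷ g) h e)) (cong (_▷ opp g) (▷-cancel p g e)))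
      (D-≢-opp-opp De ¬Dh ∷ D-≢-opp-opp De ¬Dg ∷ D-≢-opp-opp De ¬Dg ∷ [])
  ...   | inj₂ (_ , here refl , _ , in-B) =
    opposite-∉ g De De ¬Dg ¬Dḡ (subst B (trans (▷-cancel (p ▷ g) h e) (▷-comm p g e)) in-B) eḡ∈
  ...   | inj₂ (_ , there (here refl) , _ , in-B) = ¬X-opp⇒Nbr-free ¬Xh̄ De ¬Dh (subst B (▷-cancel₂ p g h e) in-B)
  ...   | inj₂ (_ , there (there (here refl)) , _ , in-B) = ¬X-opp⇒Nbr-free ¬Xh̄ De ¬Dh (subst B (▷-cancel₂ p g h e) in-B)
  -- Distance does not exclude `p ▷ g ▷ h ▷ e`. A second exchange towards the same target, along
  -- `opp h`, removes `h` and leaves `p ▷ g ▷ e` or `p ▷ e`.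
  ...   | inj₁ ghe∈
    with exchange-along ex (p ▷ g ▷ h ▷ e) (opp h) (opp g ∷ opp g ∷ []) ghe∈ eḡ∈
      (trans (cong (λ r → r ▷ opp g ▷ opp g) (▷-cancel (p ▷ g) h e)) (cong (_▷ opp g) (▷-cancel p g e)))
      (h̄≢ ∷ h̄≢ ∷ [])
    where
    h̄≢ : opp h ≢ opp (opp g)
    h̄≢ eq = u≢v (sym (cong proj₁ eq))
  ...     | inj₁ in-B =
    opposite-∉ g De De ¬Dg ¬Dḡ (subst B (trans (▷-cancel (p ▷ g) h e) (▷-comm p g e)) in-B) eḡ∈
  ...     | inj₂ (_ , here refl , _ , in-B) =
    one∉ De (subst B (trans (cong (_▷ opp g) (▷-cancel (p ▷ g) h e)) (▷-cancel p g e)) in-B)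
  ...     | inj₂ (_ , there (here refl) , _ , in-B) =
    one∉ De (subst B (trans (cong (_▷ opp g) (▷-cancel (p ▷ g) h e)) (▷-cancel p g e)) in-B)

  p-maximal : ∀ {r} → r ∈ B → ⟪ r , x ⟫ ℤ.≤ ⟪ p , x ⟫
  p-maximal r∈B = local⇒global ex x _ ℕ.≤-refl p∈B r∈B
    (λ {e} _ xe → local₁ {e} (x⇒X {e} xe))
    (λ {e} {f} te tf f≢e xe xf → local₂ {e} {f} (x⇒X {e} xe) (x≢-1⇒¬X-opp {f} xf) (Toward-base te tf f≢e))

  -- The step to `p ▷ e` already gains one, and `q` is at least as far along every element of `X`:
  -- along directions by integrality, along a neighbour `g` because `opp g` is not a direction.
  q-beyond : ∀ {e} → D e → ⟪ p , x ⟫ ℤ.< ⟪ q , x ⟫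
  q-beyond {e} De = ℤ.suc[i]≤j⇒i<j (ℤ.≤-trans (ℤ.≤-reflexive (sym (⟪⟫-▷-1 p x e (X⇒x (inj₁ De)))))
    (⟪⟫-mono (p ▷ e) q x λ g xg → below g (x⇒X xg)))
    where
    below : ∀ g → X g → (p ▷ e) ⟨ g ⟩ ℤ.≤ q ⟨ g ⟩
    below g (inj₁ (toward p<q)) = ℤ.≤-trans (▷-≤suc p e g) (ℤ.i<j⇒suc[i]≤j p<q)
    below g (inj₂ (_ , _ , _ , ¬Dg , ¬Dḡ)) =
      ℤ.≤-trans (▷-nonincreasing p e g (D-≢ De ¬Dg ∘ sym)) (¬Toward (¬Dḡ ∘ Toward-opp))

no-direction⇒≡ : {p q : Point n} → (∀ e → ¬ Toward p q e) → p ≡ q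
no-direction⇒≡ {p = p} {q} none = lookup-ext λ u →
  decidable-stable (lookup p u ℤ.≟ lookup q u) λ p≢q → none _ (proj₂ (Toward-≢ u p≢q))

-- The support function

module SupportFunction (em : ExcludedMiddle ℓ) {B : Pred (Point n) ℓ} (ex : Exchange B) {o : Point n} (o∈B : o ∈ B) where

  Attained : Vec Trit n → Set ℓ
  Attained x = ∃[ p ] p ∈ B × (∀ r → r ∈ B → ⟪ r , x ⟫ ℤ.≤ ⟪ p , x ⟫)

  -- The decision is an argument so that proofs can split on it. By `bounded⇒attained`, `⊤⁺` occurs
  -- only for functionals unbounded on `B`.
  value : ∀ {x} → Dec (Attained x) → ℤ ⁺
  value {x} (yes (p , _)) = [ ⟪ p , x ⟫ ]
  value     (no _)        = ⊤⁺

  f : Vec Trit n → ℤ ⁺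
  f x = value {x} em

  -- Each improvement raises an integer value by at least one, and the gap to `M` at `o` bounds the
  -- number of improvements.
  bounded⇒attained : ∀ {x} M → (∀ r → r ∈ B → ⟪ r , x ⟫ ℤ.≤ M) → Attained x
  bounded⇒attained {x} M bound = climb ∣ M ℤ.- ⟪ o , x ⟫ ∣ o∈B (ℤ.≤-reflexive (sym (begin
    ⟪ o , x ⟫ ℤ.+ + ∣ M ℤ.- ⟪ o , x ⟫ ∣   ≡⟨ cong (ℤ._+_ ⟪ o , x ⟫) (ℤ.0≤i⇒+∣i∣≡i (ℤ.i≤j⇒0≤j-i (bound o o∈B))) ⟩
    ⟪ o , x ⟫ ℤ.+ (M ℤ.- ⟪ o , x ⟫)       ≡⟨ i+[j-i]≡j ⟪ o , x ⟫ M ⟩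
    M                                     ∎)))
    where
    open ≡-Reasoning
    step : ∀ i k → i ℤ.+ (1ℤ ℤ.+ k) ≡ (1ℤ ℤ.+ i) ℤ.+ k
    step = solve-∀
    climb : ∀ k {p} → p ∈ B → M ℤ.≤ ⟪ p , x ⟫ ℤ.+ + k → Attained x
    climb zero {p} p∈B M≤ = p , p∈B , λ r r∈B → ℤ.≤-trans (bound r r∈B) (subst (M ℤ.≤_) (ℤ.+-identityʳ ⟪ p , x ⟫) M≤)
    climb (suc k) {p} p∈B M≤ with em {∃[ r ] r ∈ B × ⟪ p , x ⟫ ℤ.< ⟪ r , x ⟫}
    ... | no none = p , p∈B , λ r r∈B → ℤ.≮⇒≥ λ p<r → none (r , r∈B , p<r)
    ... | yes (r , r∈B , p<r) = climb k r∈B (ℤ.≤-trans M≤ (ℤ.≤-trans (ℤ.≤-reflexive (step ⟪ p , x ⟫ (+ k)))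
                                  (ℤ.+-monoˡ-≤ (+ k) (ℤ.i<j⇒suc[i]≤j p<r))))

  value-upper : ∀ {x p} (d : Dec (Attained x)) → p ∈ B → [ ⟪ p , x ⟫ ] ≤⁺ value d
  value-upper (yes (_ , _ , max)) p∈B = ≤[ max _ p∈B ]
  value-upper (no _)              p∈B = _ ≤⊤⁺

  value-least : ∀ {x} M (d : Dec (Attained x)) → (∀ r → r ∈ B → ⟪ r , x ⟫ ℤ.≤ M) → value d ≤⁺ [ M ]
  value-least M (yes (p , p∈B , _)) bound = ≤[ bound p p∈B ]
  value-least M (no ¬att)           bound = contradiction (bounded⇒attained M bound) ¬att

  ⟪,0⟫ : ∀ {m} (p : Point m) → ⟪ p , replicate m 0ₜ ⟫ ≡ 0ℤ
  ⟪,0⟫ []      = refl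
  ⟪,0⟫ (a ∷ p) = cong₂ ℤ._+_ (ℤ.*-zeroʳ a) (⟪,0⟫ p)

  value-0 : (d : Dec (Attained (replicate n 0ₜ))) → value d ≡ [ 0ℤ ]
  value-0 (yes (p , _)) = cong [_] (⟪,0⟫ p)
  value-0 (no ¬att)     = contradiction (bounded⇒attained 0ℤ λ r _ → ℤ.≤-reflexive (⟪,0⟫ r)) ¬att

  ⊓⊑⊔ : ∀ (x y : Vec Trit n) e → (x ⊓ᵛ y) ⟦ e ⟧ ≡ 1ₜ → (x ⊔ᵛ y) ⟦ e ⟧ ≡ 1ₜ
  ⊓⊑⊔ x y e xye = trans (⟦⟧-⊔ x y e) (trits (x ⟦ e ⟧) (y ⟦ e ⟧) (trans (sym (⟦⟧-⊓ x y e)) xye))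
    where
    trits : ∀ s t → s ⊓ t ≡ 1ₜ → s ⊔ t ≡ 1ₜ
    trits -1ₜ -1ₜ ()
    trits -1ₜ 0ₜ ()
    trits -1ₜ 1ₜ ()
    trits 1ₜ -1ₜ ()
    trits 1ₜ 0ₜ ()
    trits 1ₜ 1ₜ _ = refl

  -- Points chosen separately for the meet and the join can be replaced by one point `r`, at which
  -- `⟪⟫-modular` turns the sum into ⟨r, x⟩ + ⟨r, y⟩.
  value-bisubmodular : ∀ x y (dx : Dec (Attained x)) (dy : Dec (Attained y))
    (d⊓ : Dec (Attained (x ⊓ᵛ y))) (d⊔ : Dec (Attained (x ⊔ᵛ y))) → value d⊓ +⁺ value d⊔ ≤⁺ value dx +⁺ value dy
  value-bisubmodular x y (no _)  _      _ _ = _ ≤⊤⁺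
  value-bisubmodular x y (yes _) (no _) _ _ = _ ≤⊤⁺
  value-bisubmodular x y (yes (px , _ , max-x)) (yes (py , _ , max-y)) d⊓ d⊔ = combine d⊓ d⊔
    where
    M = ⟪ px , x ⟫ ℤ.+ ⟪ py , y ⟫
    pair-bound : ∀ p q → p ∈ B → q ∈ B → ⟪ p , x ⊓ᵛ y ⟫ ℤ.+ ⟪ q , x ⊔ᵛ y ⟫ ℤ.≤ M
    pair-bound p q p∈B q∈B with common-maximiser ex (x ⊓ᵛ y) (x ⊔ᵛ y) (⊓⊑⊔ x y) _ ℕ.≤-refl p∈B q∈B
    ... | r , r∈B , p≤r , q≤r = ℤ.≤-trans (ℤ.+-mono-≤ p≤r q≤r)
      (ℤ.≤-trans (ℤ.≤-reflexive (⟪⟫-modular r x y)) (ℤ.+-mono-≤ (max-x r r∈B) (max-y r r∈B)))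
    move : ∀ {i j k} → i ℤ.+ j ℤ.≤ k → i ℤ.≤ k ℤ.- j
    move {i} {j} le = subst (ℤ._≤ _) (lemma i j) (ℤ.+-monoˡ-≤ (ℤ.- j) le)
      where
      lemma : ∀ i j → i ℤ.+ j ℤ.- j ≡ i
      lemma = solve-∀
    combine : ∀ d⊓ d⊔ → value d⊓ +⁺ value d⊔ ≤⁺ [ M ]
    combine (yes (p , p∈B , _)) (yes (q , q∈B , _)) = ≤[ pair-bound p q p∈B q∈B ]
    -- The bound on pairs also gives finiteness: with one point fixed at `o`, the other functional
    -- is bounded.
    combine (no ¬att) _ = contradiction
      (bounded⇒attained (M ℤ.- ⟪ o , x ⊔ᵛ y ⟫) λ r r∈B → move {⟪ r , x ⊓ᵛ y ⟫} (pair-bound r o r∈B o∈B)) ¬att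
    combine (yes _) (no ¬att) = contradiction
      (bounded⇒attained (M ℤ.- ⟪ o , x ⊓ᵛ y ⟫) λ r r∈B → move {⟪ r , x ⊔ᵛ y ⟫}
        (subst (ℤ._≤ M) (ℤ.+-comm ⟪ o , x ⊓ᵛ y ⟫ _) (pair-bound o r o∈B r∈B))) ¬att

  isIntegralBisubmodular : IsIntegralBisubmodular f
  isIntegralBisubmodular = record
    { f0≡0         = value-0 em
    ; bisubmodular = λ x y → value-bisubmodular x y em em em em
    }

  Pℤ⊆B : ∀ {q} → q ∈ Pℤ f → q ∈ B
  Pℤ⊆B {q} q∈P with closest em B q _ o ℕ.≤-refl o∈B
  ... | p , p∈B , p-closest with any-signed? (toward? p q)
  ... | no none = subst B (no-direction⇒≡ λ e t → none (e , t)) p∈B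
  ... | yes (e , De) = contradiction
    (ℤ.<-≤-trans (S.q-beyond De) ([≤]-injective (≤⁺-trans ℤ.≤-trans (q∈P S.x) (value-least _ em λ r → S.p-maximal))))
    (ℤ.<-irrefl refl)
    where module S = Separation em ex {p} {q} p∈B p-closest

  bs-convex : BS-Convex B
  bs-convex = f , isIntegralBisubmodular , (λ p∈B x → value-upper em p∈B) , Pℤ⊆B

-- Hall's theorem with multiplicities

∑-mono : {f g : Fin n → ℕ} → (∀ i → f i ℕ.≤ g i) → ∑ f ℕ.≤ ∑ g
∑-mono {zero}  f≤g = ℕ.z≤n
∑-mono {suc n} f≤g = ℕ.+-mono-≤ (f≤g zero) (∑-mono (f≤g ∘ suc))

∑≡0⇒≡0 : (f : Fin n → ℕ) → ∑ f ≡ 0 → ∀ i → f i ≡ 0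
∑≡0⇒≡0 f eq zero    = ℕ.m+n≡0⇒m≡0 _ eq
∑≡0⇒≡0 f eq (suc i) = ∑≡0⇒≡0 (f ∘ suc) (ℕ.m+n≡0⇒n≡0 (f zero) eq) i

∑-0 : (f : Fin n → ℕ) → (∀ i → f i ≡ 0) → ∑ f ≡ 0
∑-0 {n} f f≡0 = trans (sum-cong-≗ f≡0) (sum-replicate-zero n)

δ : Fin n → Fin n → ℕ
δ zero    zero    = 1
δ zero    (suc _) = 0
δ (suc _) zero    = 0
δ (suc u) (suc v) = δ u v

δ-same : (u : Fin n) → δ u u ≡ 1
δ-same zero    = refl
δ-same (suc u) = δ-same u

δ-≢ : (u v : Fin n) → u ≢ v → δ u v ≡ 0
δ-≢ zero    zero    u≢v = contradiction refl u≢v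
δ-≢ zero    (suc _) _   = refl
δ-≢ (suc _) zero    _   = refl
δ-≢ (suc u) (suc v) u≢v = δ-≢ u v (u≢v ∘ cong suc)

Sub : ℕ → Set
Sub n = Fin n → Bool

wt : (Fin n → ℕ) → Sub n → ℕ
wt a S = ∑ λ u → if S u then a u else 0

wt-+ : (a c : Fin n → ℕ) (S : Sub n) → wt (λ u → a u ℕ.+ c u) S ≡ wt a S ℕ.+ wt c S
wt-+ a c S = trans (sum-cong-≗ λ u → split u (S u)) (∑-distrib-+ (λ u → if S u then a u else 0) (λ u → if S u then c u else 0))
  where
  split : ∀ u s → (if s then a u ℕ.+ c u else 0) ≡ (if s then a u else 0) ℕ.+ (if s then c u else 0)
  split u true  = refl
  split u false = refl

wt-cong : {a c : Fin n → ℕ} (S : Sub n) → (∀ u → a u ≡ c u) → wt a S ≡ wt c S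
wt-cong S a≗c = sum-cong-≗ λ u → cong (λ k → if S u then k else 0) (a≗c u)

∑-δ : (u : Fin n) → ∑ (δ u) ≡ 1
∑-δ {suc n} zero    = cong suc (∑-0 {n} _ λ _ → refl)
∑-δ         (suc u) = ∑-δ u

wt-δ : (u : Fin n) (S : Sub n) → wt (δ u) S ≡ (if S u then 1 else 0)
wt-δ zero S = trans (cong ((if S zero then 1 else 0) ℕ.+_) (∑-0 _ λ v → Bool.if-eta (S (suc v)))) (ℕ.+-identityʳ _)
wt-δ (suc u) S = trans (cong (ℕ._+ wt (δ u) (S ∘ suc)) (Bool.if-eta (S zero))) (wt-δ u (S ∘ suc))

wt-∪∩ : (a : Fin n → ℕ) (S T : Sub n) → wt a (λ u → S u ∨ T u) ℕ.+ wt a (λ u → S u ∧ T u) ≡ wt a S ℕ.+ wt a T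
wt-∪∩ a S T = begin
  wt a (λ u → S u ∨ T u) ℕ.+ wt a (λ u → S u ∧ T u)  ≡⟨ ∑-distrib-+ _ (λ u → if S u ∧ T u then a u else 0) ⟨
  ∑ (λ u → (if S u ∨ T u then a u else 0) ℕ.+ (if S u ∧ T u then a u else 0))  ≡⟨ sum-cong-≗ (λ u → pointwise (a u) (S u) (T u)) ⟩
  ∑ (λ u → (if S u then a u else 0) ℕ.+ (if T u then a u else 0))              ≡⟨ ∑-distrib-+ _ (λ u → if T u then a u else 0) ⟩
  wt a S ℕ.+ wt a T  ∎
  where
  open ≡-Reasoning
  pointwise : ∀ k s t → (if s ∨ t then k else 0) ℕ.+ (if s ∧ t then k else 0) ≡ (if s then k else 0) ℕ.+ (if t then k else 0)
  pointwise k true  true  = refl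
  pointwise k true  false = refl
  pointwise k false true  = ℕ.+-identityʳ k
  pointwise k false false = refl

decrement : (a : Fin n → ℕ) (u : Fin n) → 0 ℕ.< a u → ∀ w → a w ≡ (a w ℕ.∸ δ u w) ℕ.+ δ u w
decrement a u 0<au w = sym (ℕ.m∸n+n≡m δ≤a)
  where
  δ≤a : δ u w ℕ.≤ a w
  δ≤a with u Fin.≟ w
  ... | yes refl = ℕ.≤-trans (ℕ.≤-reflexive (δ-same u)) 0<au
  ... | no u≢w   = ℕ.≤-trans (ℕ.≤-reflexive (δ-≢ u w u≢w)) ℕ.z≤n

count₁ : {m : ℕ} → List (Fin n × Fin m) → Fin n → ℕ
count₁ []            w = 0
count₁ ((u , _) ∷ L) w = δ u w ℕ.+ count₁ L w

count₂ : {m : ℕ} → List (Fin n × Fin m) → Fin m → ℕ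
count₂ []            w = 0
count₂ ((_ , v) ∷ L) w = δ v w ℕ.+ count₂ L w

module Hall (em₀ : ExcludedMiddle 0ℓ) {m : ℕ} (E : Fin n → Fin m → Set ℓ) (E? : ∀ u v → Dec (E u v)) where

  nbr? : (S : Sub n) (v : Fin m) → Dec (∃[ u ] S u ≡ true × E u v)
  nbr? S v = Fin.any? λ u → (S u Bool.≟ true) ×-dec E? u v

  N : Sub n → Sub m
  N S v = does (nbr? S v)

  N-intro : ∀ S {u v} → S u ≡ true → E u v → N S v ≡ true
  N-intro S {u} {v} Su Euv with nbr? S v
  ... | yes _   = refl
  ... | no none = contradiction (u , Su , Euv) none

  N-elim : ∀ S {v} → N S v ≡ true → ∃[ u ] S u ≡ true × E u v
  N-elim S {v} NSv with nbr? S v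
  ... | yes found = found

  -- A neighbour of S ∪ T is a neighbour of S or of T, and a neighbour of S ∩ T is one of both; the
  -- converse of the latter can fail, hence only an inequality.
  wt-N-submodular : (b : Fin m → ℕ) (S T : Sub n) →
    wt b (N (λ u → S u ∨ T u)) ℕ.+ wt b (N (λ u → S u ∧ T u)) ℕ.≤ wt b (N S) ℕ.+ wt b (N T)
  wt-N-submodular b S T = begin
    wt b (N S∪T) ℕ.+ wt b (N S∩T)
      ≡⟨ ∑-distrib-+ _ (λ v → if N S∩T v then b v else 0) ⟨
    ∑ (λ v → (if N S∪T v then b v else 0) ℕ.+ (if N S∩T v then b v else 0))
      ≤⟨ ∑-mono (λ v → pointwise (b v) (N S∪T v) (N S∩T v) (N S v) (N T v) (∪-case v) (∩-case v)) ⟩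
    ∑ (λ v → (if N S v then b v else 0) ℕ.+ (if N T v then b v else 0))
      ≡⟨ ∑-distrib-+ _ (λ v → if N T v then b v else 0) ⟩
    wt b (N S) ℕ.+ wt b (N T) ∎
    where
    open ℕ.≤-Reasoning
    S∪T S∩T : Sub n
    S∪T u = S u ∨ T u
    S∩T u = S u ∧ T u
    ∪-case : ∀ v → N S∪T v ≡ true → N S v ≡ true ⊎ N T v ≡ true
    ∪-case v Nv with N-elim S∪T Nv
    ... | u , ∪u , Euv with S u in Su
    ...   | true  = inj₁ (N-intro S Su Euv)
    ...   | false = inj₂ (N-intro T ∪u Euv)
    ∩-case : ∀ v → N S∩T v ≡ true → N S v ≡ true × N T v ≡ true
    ∩-case v Nv with N-elim S∩T Nv
    ... | u , ∩u , Euv with S u in Su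
    ...   | true = N-intro S Su Euv , N-intro T ∩u Euv
    pointwise : ∀ k c d s t → (c ≡ true → s ≡ true ⊎ t ≡ true) → (d ≡ true → s ≡ true × t ≡ true) →
      (if c then k else 0) ℕ.+ (if d then k else 0) ℕ.≤ (if s then k else 0) ℕ.+ (if t then k else 0)
    pointwise k false false s     t     _ _ = ℕ.z≤n
    pointwise k false true  s     t     _ ∩ with ∩ refl
    ... | refl , refl = ℕ.m≤n+m k k
    pointwise k true  true  s     t     _ ∩ with ∩ refl
    ... | refl , refl = ℕ.≤-refl
    pointwise k true  false true  t     _ _ = ℕ.+-monoʳ-≤ k ℕ.z≤n
    pointwise k true  false false true  _ _ = ℕ.≤-reflexive (ℕ.+-identityʳ k)
    pointwise k true  false false false ∪ _ with ∪ refl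
    ... | inj₁ ()
    ... | inj₂ ()

  Condition : (Fin n → ℕ) → (Fin m → ℕ) → Set
  Condition a b = ∀ S → wt a S ℕ.≤ wt b (N S)

  -- Equality in Hall's condition; the other half is `Condition`.
  Tight : (Fin n → ℕ) → (Fin m → ℕ) → Sub n → Set
  Tight a b S = wt b (N S) ℕ.≤ wt a S

  -- Uncrossing: neighbourhood weight is submodular and `wt a` is modular, so tightness of both sets
  -- and `Condition` at the intersection leave no gap at the union.
  Tight-∪ : ∀ {a b} → Condition a b → ∀ {S T} → Tight a b S → Tight a b T → Tight a b (λ u → S u ∨ T u)
  Tight-∪ {a} {b} cond {S} {T} tS tT = ℕ.+-cancelʳ-≤ (wt b (N S∩T)) _ _ (begin
    wt b (N S∪T) ℕ.+ wt b (N S∩T)  ≤⟨ wt-N-submodular b S T ⟩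
    wt b (N S) ℕ.+ wt b (N T)      ≤⟨ ℕ.+-mono-≤ tS tT ⟩
    wt a S ℕ.+ wt a T              ≡⟨ wt-∪∩ a S T ⟨
    wt a S∪T ℕ.+ wt a S∩T          ≤⟨ ℕ.+-monoʳ-≤ (wt a S∪T) (cond S∩T) ⟩
    wt a S∪T ℕ.+ wt b (N S∩T)      ∎)
    where
    open ℕ.≤-Reasoning
    S∪T S∩T : Sub n
    S∪T u = S u ∨ T u
    S∩T u = S u ∧ T u

  -- The obstruction to matching `u` with `v`: lowering both by one would reduce the neighbourhood
  -- weight of a tight set but not the weight of the set.
  Blocked : (Fin n → ℕ) → (Fin m → ℕ) → Fin n → Fin m → Set
  Blocked a b u v = ∃[ S ] Tight a b S × S u ≡ false × N S v ≡ true

  -- Each side drops by at most one, so the condition can fail at `S` only if it held with equality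
  -- and just the neighbourhood side drops; then `S` is a blocker.
  ¬Blocked⇒Condition : ∀ {a b u v} → Condition a b → 0 ℕ.< a u → 0 ℕ.< b v → ¬ Blocked a b u v →
    Condition (λ w → a w ℕ.∸ δ u w) (λ w → b w ℕ.∸ δ v w)
  ¬Blocked⇒Condition {a} {b} {u} {v} cond 0<au 0<bv ¬blocked S = decidable-stable (_ ℕ.≤? _) λ ≰ →
    violated (S u) (N S v) refl refl (ℕ.≰⇒> ≰) (subst₂ ℕ._≤_ (split a u 0<au S) (split b v 0<bv (N S)) (cond S))
    where
    split : ∀ {k} (c : Fin k → ℕ) w → 0 ℕ.< c w → ∀ T → wt c T ≡ wt (λ i → c i ℕ.∸ δ w i) T ℕ.+ (if T w then 1 else 0)
    split c w 0<cw T = trans (wt-cong T (decrement c w 0<cw))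
      (trans (wt-+ (λ i → c i ℕ.∸ δ w i) (δ w) T) (cong (wt (λ i → c i ℕ.∸ δ w i) T ℕ.+_) (wt-δ w T)))
    a′ = wt (λ w → a w ℕ.∸ δ u w) S
    b′ = wt (λ w → b w ℕ.∸ δ v w) (N S)
    violated : ∀ s t → S u ≡ s → N S v ≡ t → b′ ℕ.< a′ →
      a′ ℕ.+ (if S u then 1 else 0) ℕ.≤ b′ ℕ.+ (if N S v then 1 else 0) → ⊥
    violated true t Su Nv b′<a′ le rewrite Su = ℕ.<⇒≱ b′<a′ (ℕ.+-cancelʳ-≤ 1 a′ b′ (ℕ.≤-trans le (ℕ.+-monoʳ-≤ b′ (≤1 (N S v)))))
      where
      ≤1 : ∀ s → (if s then 1 else 0) ℕ.≤ 1
      ≤1 true  = ℕ.≤-refl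
      ≤1 false = ℕ.z≤n
    violated false false Su Nv b′<a′ le rewrite Su | Nv = ℕ.<⇒≱ b′<a′ (ℕ.+-cancelʳ-≤ 0 a′ b′ le)
    violated false true Su Nv b′<a′ le = ¬blocked (S , tight , Su , Nv)
      where
      open ℕ.≤-Reasoning
      tight : Tight a b S
      tight = begin
        wt b (N S)                            ≡⟨ split b v 0<bv (N S) ⟩
        b′ ℕ.+ (if N S v then 1 else 0)       ≡⟨ cong (λ t → b′ ℕ.+ (if t then 1 else 0)) Nv ⟩
        b′ ℕ.+ 1                              ≡⟨ ℕ.+-comm b′ 1 ⟩
        suc b′                                ≤⟨ b′<a′ ⟩
        a′                                    ≤⟨ ℕ.m≤m+n a′ _ ⟩
        a′ ℕ.+ (if S u then 1 else 0)         ≡⟨ split a u 0<au S ⟨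
        wt a S                                ∎

  -- By `Tight-∪` the blockers of the edges at `u` merge into one tight set, which still omits `u`
  -- but reaches every listed neighbour of `u` with positive weight.
  union-of-blockers : ∀ {a b u} → Condition a b → (∀ v → E u v → 0 ℕ.< b v → Blocked a b u v) →
    (vs : List (Fin m)) → ∃[ T ] Tight a b T × T u ≡ false × (∀ {v} → v ∈ˡ vs → E u v → 0 ℕ.< b v → N T v ≡ true)
  union-of-blockers {a} {b} cond blocked [] = (λ _ → false) , tight , refl , λ ()
    where
    ∅ : Sub n
    ∅ _ = false
    N∅ : ∀ v → N ∅ v ≡ false
    N∅ v with nbr? ∅ v
    ... | no _ = refl
    tight : Tight a b ∅
    tight = ℕ.≤-trans (ℕ.≤-reflexive (∑-0 _ λ v → cong (λ s → if s then b v else 0) (N∅ v))) ℕ.z≤n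
  union-of-blockers {a} {b} {u} cond blocked (v ∷ vs)
    with union-of-blockers cond blocked vs | (E? u v ×-dec (0 ℕ.<? b v))
  ... | T , tT , ¬Tu , covers | no ¬Ev = T , tT , ¬Tu , λ where
    (here refl) Euv 0<bv → contradiction (Euv , 0<bv) ¬Ev
    (there v∈) → covers v∈
  ... | T , tT , ¬Tu , covers | yes (Euv , 0<bv) with blocked v Euv 0<bv
  ... | S , tS , ¬Su , Nv = S∪T , Tight-∪ cond tS tT , cong₂ _∨_ ¬Su ¬Tu , covers⁺
    where
    S∪T : Sub n
    S∪T w = S w ∨ T w
    covers⁺ : ∀ {v′} → v′ ∈ˡ v ∷ vs → E u v′ → 0 ℕ.< b v′ → N S∪T v′ ≡ true
    covers⁺ (here refl) _ _ with N-elim S Nv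
    ... | w , Sw , Ewv = N-intro S∪T (cong (_∨ T w) Sw) Ewv
    covers⁺ (there v∈) Euv 0<bv with N-elim T (covers v∈ Euv 0<bv)
    ... | w , Tw , Ewv = N-intro S∪T (trans (cong (S w ∨_) Tw) (Bool.∨-zeroʳ (S w))) Ewv

  -- Adding `u` to the merged blocker raises its weight but not that of its neighbourhood, contrary
  -- to `Condition`.
  unblocked : ∀ {a b u} → Condition a b → 0 ℕ.< a u → ¬ (∀ v → E u v → 0 ℕ.< b v → Blocked a b u v)
  unblocked {a} {b} {u} cond 0<au blocked with union-of-blockers cond blocked (List.allFin m)
  ... | T , tT , ¬Tu , covers = ℕ.<-irrefl refl (begin-strict
    wt a T                ≡⟨ ℕ.+-identityʳ (wt a T) ⟨
    wt a T ℕ.+ 0          <⟨ ℕ.+-monoʳ-< (wt a T) (ℕ.n<1+n 0) ⟩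
    wt a T ℕ.+ 1          ≡⟨ cong (wt a T ℕ.+_) (∑-δ u) ⟨
    wt a T ℕ.+ ∑ (δ u)    ≡⟨ ∑-distrib-+ _ (δ u) ⟨
    ∑ (λ w → (if T w then a w else 0) ℕ.+ δ u w)  ≤⟨ ∑-mono grow ⟩
    wt a T⁺               ≤⟨ cond T⁺ ⟩
    wt b (N T⁺)           ≤⟨ ∑-mono shrink ⟩
    wt b (N T)            ≤⟨ tT ⟩
    wt a T                ∎)
    where
    open ℕ.≤-Reasoning
    T⁺ : Sub n
    T⁺ w = T w ∨ does (u Fin.≟ w)
    grow : ∀ w → (if T w then a w else 0) ℕ.+ δ u w ℕ.≤ (if T⁺ w then a w else 0)
    grow w with u Fin.≟ w
    ... | yes refl rewrite ¬Tu | δ-same u = 0<au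
    ... | no u≢w rewrite δ-≢ u w u≢w | Bool.∨-identityʳ (T w) = ℕ.≤-reflexive (ℕ.+-identityʳ _)
    shrink : ∀ v → (if N T⁺ v then b v else 0) ℕ.≤ (if N T v then b v else 0)
    shrink v with N T⁺ v in NT⁺v | N T v in NTv | b v in bv
    ... | false | _     | _     = ℕ.z≤n
    ... | true  | true  | _     = ℕ.≤-refl
    ... | true  | false | zero  = ℕ.z≤n
    ... | true  | false | suc _ with N-elim T⁺ NT⁺v
    ...   | w , T⁺w , Ewv with u Fin.≟ w
    ...     | yes refl = case trans (sym NTv) (covers (∈-allFin v) Ewv (subst (0 ℕ.<_) (sym bv) ℕ.z<s)) of λ ()
    ...     | no _ = case trans (sym NTv) (N-intro T (trans (sym (Bool.∨-identityʳ (T w))) T⁺w) Ewv) of λ ()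

  Matching : (Fin n → ℕ) → (Fin m → ℕ) → Set ℓ
  Matching a b = ∃[ L ] All (λ (u , v) → E u v) L × (∀ w → a w ≡ count₁ L w) × (∀ w → b w ≡ count₂ L w)

  ∑-decrement : ∀ {j k} (c : Fin j → ℕ) w → 0 ℕ.< c w → ∑ c ≡ suc k → ∑ (λ i → c i ℕ.∸ δ w i) ≡ k
  ∑-decrement {k = k} c w 0<cw ∑c = ℕ.suc-injective (begin
    suc (∑ (λ i → c i ℕ.∸ δ w i))          ≡⟨ ℕ.+-comm 1 _ ⟩
    ∑ (λ i → c i ℕ.∸ δ w i) ℕ.+ 1          ≡⟨ cong (∑ (λ i → c i ℕ.∸ δ w i) ℕ.+_) (∑-δ w) ⟨
    ∑ (λ i → c i ℕ.∸ δ w i) ℕ.+ ∑ (δ w)    ≡⟨ ∑-distrib-+ _ (δ w) ⟨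
    ∑ (λ i → (c i ℕ.∸ δ w i) ℕ.+ δ w i)    ≡⟨ sum-cong-≗ (decrement c w 0<cw) ⟨
    ∑ c                                    ≡⟨ ∑c ⟩
    suc k                                  ∎)
    where open ≡-Reasoning

  -- Induction on the total demand: match some `u` of positive demand along an unblocked edge and
  -- lower both ends by one.
  hall : ∀ k a b → ∑ a ≡ k → ∑ b ≡ k → Condition a b → Matching a b
  hall zero a b ∑a ∑b cond = [] , [] , ∑≡0⇒≡0 a ∑a , ∑≡0⇒≡0 b ∑b
  hall (suc k) a b ∑a ∑b cond with Fin.any? (λ u → 0 ℕ.<? a u)
  ... | no none = contradiction (trans (sym ∑a) (∑-0 a λ u → ℕ.n≤0⇒n≡0 (ℕ.≮⇒≥ λ 0<au → none (u , 0<au)))) λ ()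
  ... | yes (u , 0<au) with Fin.any? (λ v → E? u v ×-dec (0 ℕ.<? b v) ×-dec Dec.¬? (em₀ {Blocked a b u v}))
  ... | no none = contradiction (λ v Euv 0<bv → decidable-stable em₀ λ ¬blocked → none (v , Euv , 0<bv , ¬blocked))
                    (unblocked cond 0<au)
  ... | yes (v , Euv , 0<bv , ¬blocked)
    with hall k _ _ (∑-decrement a u 0<au ∑a) (∑-decrement b v 0<bv ∑b) (¬Blocked⇒Condition cond 0<au 0<bv ¬blocked)
  ... | L , EL , a≡ , b≡ = (u , v) ∷ L , Euv ∷ EL , restore a u 0<au a≡ , restore b v 0<bv b≡
    where
    restore : ∀ {j} (c : Fin j → ℕ) w → 0 ℕ.< c w → {d : Fin j → ℕ} → (∀ i → c i ℕ.∸ δ w i ≡ d i) → ∀ i → c i ≡ δ w i ℕ.+ d i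
    restore c w 0<cw c≡ i = trans (decrement c w 0<cw i) (trans (ℕ.+-comm _ (δ w i)) (cong (δ w i ℕ.+_) (c≡ i)))

-- Half-integral combinations

-- Unnormalised rationals add without reduction, so equations between fractions become ring
-- identities over `ℤ`.
/-+ : ∀ x y → fromℚᵘ x ℚ.+ fromℚᵘ y ≡ fromℚᵘ (x ℚᵘ.+ y)
/-+ x y = ℚ.toℚᵘ-injective (begin
  ℚ.toℚᵘ (fromℚᵘ x ℚ.+ fromℚᵘ y)                    ≈⟨ ℚ.toℚᵘ-homo-+ (fromℚᵘ x) (fromℚᵘ y) ⟩
  ℚ.toℚᵘ (fromℚᵘ x) ℚᵘ.+ ℚ.toℚᵘ (fromℚᵘ y)          ≈⟨ ℚᵘ.+-cong (ℚ.toℚᵘ-fromℚᵘ x) (ℚ.toℚᵘ-fromℚᵘ y) ⟩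
  x ℚᵘ.+ y                                          ≈⟨ ℚ.toℚᵘ-fromℚᵘ (x ℚᵘ.+ y) ⟨
  ℚ.toℚᵘ (fromℚᵘ (x ℚᵘ.+ y))                        ∎)
  where open ≈-Reasoning ℚᵘ.≃-setoid

/2-+ : ∀ i j → (i / 2) ℚ.+ (j / 2) ≡ (i ℤ.+ j) / 2
/2-+ i j = trans (/-+ (mkℚᵘ i 1) (mkℚᵘ j 1)) (ℚ.fromℚᵘ-cong {mkℚᵘ i 1 ℚᵘ.+ mkℚᵘ j 1} {mkℚᵘ (i ℤ.+ j) 1} (*≡* (lemma i j)))
  where
  lemma : ∀ i j → (i ℤ.* + 2 ℤ.+ j ℤ.* + 2) ℤ.* + 2 ≡ (i ℤ.+ j) ℤ.* + 4
  lemma = solve-∀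

/1-+-/2 : ∀ i j → (i / 1) ℚ.+ ((+ 2 ℤ.* (j ℤ.- i)) / 2) ≡ j / 1
/1-+-/2 i j = trans (/-+ (mkℚᵘ i 0) (mkℚᵘ (+ 2 ℤ.* (j ℤ.- i)) 1))
  (ℚ.fromℚᵘ-cong {mkℚᵘ i 0 ℚᵘ.+ mkℚᵘ (+ 2 ℤ.* (j ℤ.- i)) 1} {mkℚᵘ j 0} (*≡* (lemma i j)))
  where
  lemma : ∀ i j → (i ℤ.* + 2 ℤ.+ (+ 2 ℤ.* (j ℤ.- i)) ℤ.* + 1) ℤ.* + 1 ≡ j ℤ.* + 2
  lemma = solve-∀

/1-injective : ∀ i j → i / 1 ≡ j / 1 → i ≡ j
/1-injective i j eq with ℚ.fromℚᵘ-injective {mkℚᵘ i 0} {mkℚᵘ j 0} eq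
... | *≡* i*1≡j*1 = trans (sym (ℤ.*-identityʳ i)) (trans i*1≡j*1 (ℤ.*-identityʳ j))

total : List (Point n) → Fin n → ℤ
total []       w = 0ℤ
total (α ∷ αs) w = lookup α w ℤ.+ total αs w

lookup-sum-half : (αs : List (Point n)) (w : Fin n) → lookup (sumℚⱽ (List.map half αs)) w ≡ total αs w / 2
lookup-sum-half []       w = Vec.lookup-replicate w 0ℚ
lookup-sum-half (α ∷ αs) w = begin
  lookup (half α ⊕ℚ sumℚⱽ (List.map half αs)) w               ≡⟨ Vec.lookup-zipWith ℚ._+_ w (half α) _ ⟩
  lookup (half α) w ℚ.+ lookup (sumℚⱽ (List.map half αs)) w   ≡⟨ cong₂ ℚ._+_ (Vec.lookup-map w (_/ 2) α) (lookup-sum-half αs w) ⟩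
  (lookup α w / 2) ℚ.+ (total αs w / 2)                       ≡⟨ /2-+ (lookup α w) (total αs w) ⟩
  (lookup α w ℤ.+ total αs w) / 2                             ∎
  where open ≡-Reasoning

lookup-half-path : (p : Point n) (αs : List (Point n)) (w : Fin n) →
  lookup (toℚⱽ p ⊕ℚ sumℚⱽ (List.map half αs)) w ≡ (lookup p w / 1) ℚ.+ (total αs w / 2)
lookup-half-path p αs w = trans (Vec.lookup-zipWith ℚ._+_ w (toℚⱽ p) _)
  (cong₂ ℚ._+_ (Vec.lookup-map w (_/ 1) p) (lookup-sum-half αs w))

half-path : (p q : Point n) (αs : List (Point n)) →
  (∀ w → total αs w ≡ + 2 ℤ.* (lookup q w ℤ.- lookup p w)) → toℚⱽ p ⊕ℚ sumℚⱽ (List.map half αs) ≡ toℚⱽ q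
half-path p q αs eq = lookup-ext λ w → begin
  lookup (toℚⱽ p ⊕ℚ sumℚⱽ (List.map half αs)) w                        ≡⟨ lookup-half-path p αs w ⟩
  (lookup p w / 1) ℚ.+ (total αs w / 2)                                ≡⟨ cong (λ i → (lookup p w / 1) ℚ.+ (i / 2)) (eq w) ⟩
  (lookup p w / 1) ℚ.+ ((+ 2 ℤ.* (lookup q w ℤ.- lookup p w)) / 2)     ≡⟨ /1-+-/2 (lookup p w) (lookup q w) ⟩
  lookup q w / 1                                                       ≡⟨ Vec.lookup-map w (_/ 1) q ⟨
  lookup (toℚⱽ q) w                                                    ∎
  where open ≡-Reasoning

total-0 : (αs : List (Point n)) (w : Fin n) → All (λ α → lookup α w ≡ 0ℤ) αs → total αs w ≡ 0ℤ
total-0 []       w []           = refl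
total-0 (α ∷ αs) w (α≡0 ∷ αs≡0) = cong₂ ℤ._+_ α≡0 (total-0 αs w αs≡0)

BS-EXC⇒Δ-EXC : {B : Pred (Point n) ℓ} → BS-EXC B → Δ-EXC B
BS-EXC⇒Δ-EXC {B = B} bs p q p∈B q∈B u u∈ with bs p q p∈B q∈B
... | αs , αs∈ , path with Any.any? (λ α → Dec.¬? (lookup α u ℤ.≟ 0ℤ)) αs
... | yes some = let α , α∈αs , αu≢0 = find some in α , All.lookup αs∈ α∈αs , αu≢0
... | no none = contradiction (begin
  lookup (q ⊖ p) u           ≡⟨ lookup-⊖ p q u ⟩
  lookup q u ℤ.- lookup p u  ≡⟨ ℤ.i≡j⇒i-j≡0 (sym p≡q) ⟩
  0ℤ                         ∎) u∈
  where
  open ≡-Reasoning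
  αs≡0 : All (λ α → lookup α u ≡ 0ℤ) αs
  αs≡0 = All.map (λ {α} → decidable-stable (lookup α u ℤ.≟ 0ℤ)) (¬Any⇒All¬ αs none)
  p≡q : lookup p u ≡ lookup q u
  p≡q = /1-injective _ _ (begin
    lookup p u / 1                                  ≡⟨ ℚ.+-identityʳ _ ⟨
    (lookup p u / 1) ℚ.+ (0ℤ / 2)                   ≡⟨ cong (λ i → (lookup p u / 1) ℚ.+ (i / 2)) (total-0 αs u αs≡0) ⟨
    (lookup p u / 1) ℚ.+ (total αs u / 2)           ≡⟨ lookup-half-path p αs u ⟨
    lookup (toℚⱽ p ⊕ℚ sumℚⱽ (List.map half αs)) u   ≡⟨ cong (λ r → lookup r u) path ⟩
    lookup (toℚⱽ q) u                               ≡⟨ Vec.lookup-map u (_/ 1) q ⟩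
    lookup q u / 1                                  ∎)

-- From Hall's theorem to half-integral paths

signₜ : ℤ → Trit
signₜ (+ 0)    = 0ₜ
signₜ +[1+ _ ] = 1ₜ
signₜ -[1+ _ ] = -1ₜ

i*signₜ : ∀ i → i ℤ.* tritToℤ (signₜ i) ≡ + ∣ i ∣
i*signₜ (+ 0)    = refl
i*signₜ +[1+ k ] = ℤ.*-identityʳ +[1+ k ]
i*signₜ -[1+ k ] = cong +[1+_] (ℕ.*-identityʳ k)

signₜ-pos : ∀ i → 0ℤ ℤ.< i → signₜ i ≡ 1ₜ
signₜ-pos +[1+ _ ] _ = refl
signₜ-pos (+ 0) (+<+ ())

signₜ-neg : ∀ i → i ℤ.< 0ℤ → signₜ i ≡ -1ₜ
signₜ-neg -[1+ _ ] _ = refl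
signₜ-neg (+ _) (+<+ ())

-- With the flags for membership in S and N(S) and the sign of q - p, this is a coordinate of the
-- functional ±(S - N(S)); on S ∩ N(S) the two contributions cancel.
select : Bool → Bool → Trit → Trit
select true  false t = t
select false true  t = negₜ t
select true  true  t = 0ₜ
select false false t = 0ₜ

negₜ-select : ∀ s r t → negₜ (select s r t) ≡ select s r (negₜ t)
negₜ-select true  false t = refl
negₜ-select false true  t = refl
negₜ-select true  true  t = refl
negₜ-select false false t = refl

tritToℤ-neg : ∀ t → tritToℤ (negₜ t) ≡ ℤ.- tritToℤ t
tritToℤ-neg -1ₜ = refl
tritToℤ-neg 0ₜ  = refl
tritToℤ-neg 1ₜ  = refl

-- Sums a coordinatewise balance; the result is ⟨q - p, x⟩ = a(S) - a(T), written without
-- subtraction.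
⟪⟫-wt : (p q : Point n) (x : Vec Trit n) (a : Fin n → ℕ) (S T : Sub n) →
  (∀ u → lookup q u ℤ.* tritToℤ (lookup x u) ℤ.+ + (if T u then a u else 0)
       ≡ lookup p u ℤ.* tritToℤ (lookup x u) ℤ.+ + (if S u then a u else 0)) →
  ⟪ q , x ⟫ ℤ.+ + wt a T ≡ ⟪ p , x ⟫ ℤ.+ + wt a S
⟪⟫-wt [] [] [] a S T eq = refl
⟪⟫-wt (b ∷ p) (c ∷ q) (t ∷ x) a S T eq = begin
  (c ℤ.* tritToℤ t ℤ.+ ⟪ q , x ⟫) ℤ.+ + wt a T
    ≡⟨ cong (ℤ._+_ (c ℤ.* tritToℤ t ℤ.+ ⟪ q , x ⟫)) (ℤ.pos-+ (if T zero then a zero else 0) _) ⟩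
  (c ℤ.* tritToℤ t ℤ.+ ⟪ q , x ⟫) ℤ.+ (+ (if T zero then a zero else 0) ℤ.+ + wt (a ∘ suc) (T ∘ suc))
    ≡⟨ shuffle (c ℤ.* tritToℤ t) _ _ _ ⟩
  (c ℤ.* tritToℤ t ℤ.+ + (if T zero then a zero else 0)) ℤ.+ (⟪ q , x ⟫ ℤ.+ + wt (a ∘ suc) (T ∘ suc))
    ≡⟨ cong₂ ℤ._+_ (eq zero) (⟪⟫-wt p q x (a ∘ suc) (S ∘ suc) (T ∘ suc) (eq ∘ suc)) ⟩
  (b ℤ.* tritToℤ t ℤ.+ + (if S zero then a zero else 0)) ℤ.+ (⟪ p , x ⟫ ℤ.+ + wt (a ∘ suc) (S ∘ suc))
    ≡⟨ shuffle (b ℤ.* tritToℤ t) _ _ _ ⟨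
  (b ℤ.* tritToℤ t ℤ.+ ⟪ p , x ⟫) ℤ.+ (+ (if S zero then a zero else 0) ℤ.+ + wt (a ∘ suc) (S ∘ suc))
    ≡⟨ cong (ℤ._+_ (b ℤ.* tritToℤ t ℤ.+ ⟪ p , x ⟫)) (ℤ.pos-+ (if S zero then a zero else 0) _) ⟨
  (b ℤ.* tritToℤ t ℤ.+ ⟪ p , x ⟫) ℤ.+ + wt a S ∎
  where
  open ≡-Reasoning
  shuffle : ∀ i j k l → (i ℤ.+ j) ℤ.+ (k ℤ.+ l) ≡ (i ℤ.+ k) ℤ.+ (j ℤ.+ l)
  shuffle = solve-∀

-- The coordinates carry a graph whose edges are the elements of Φ_B(p , q), a
-- unit vector being a loop; a perfect matching with multiplicities |q − p| of
-- its bipartite double cover is a list of α with sum 2(q − p).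
module HalfPath (em : ExcludedMiddle ℓ) (em₀ : ExcludedMiddle 0ℓ) {B : Pred (Point n) ℓ} (ex : Exchange B)
  {p q : Point n} (p∈B : p ∈ B) (q∈B : q ∈ B) where

  diff : Fin n → ℤ
  diff u = lookup q u ℤ.- lookup p u

  a : Fin n → ℕ
  a u = ∣ diff u ∣

  -- Where `diff u` is 0 the sign is the default `Sign.+`; `Edge` demands a direction towards `q`,
  -- which excludes such coordinates.
  dir : Fin n → Signed n
  dir u = u , ℤ.sign (diff u)

  diff-pos : ∀ u → lookup p u ℤ.< lookup q u → 0ℤ ℤ.< diff u
  diff-pos u p<q = subst (ℤ._< diff u) (ℤ.+-inverseʳ (lookup p u)) (ℤ.+-monoˡ-< (ℤ.- lookup p u) p<q)

  diff-neg : ∀ u → lookup q u ℤ.< lookup p u → diff u ℤ.< 0ℤ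
  diff-neg u q<p = subst (diff u ℤ.<_) (ℤ.+-inverseʳ (lookup p u)) (ℤ.+-monoˡ-< (ℤ.- lookup p u) q<p)

  Toward⇒dir : ∀ {e} → Toward p q e → e ≡ dir (proj₁ e)
  Toward⇒dir {u , Sign.+} (toward t) = cong (u ,_) (sym (pos (diff u) (diff-pos u t)))
    where
    pos : ∀ i → 0ℤ ℤ.< i → ℤ.sign i ≡ Sign.+
    pos +[1+ _ ] _ = refl
    pos (+ 0) (+<+ ())
  Toward⇒dir {u , Sign.-} (toward t) = cong (u ,_) (sym (neg (diff u) (diff-neg u (ℤ.neg-cancel-< t))))
    where
    neg : ∀ i → i ℤ.< 0ℤ → ℤ.sign i ≡ Sign.-
    neg -[1+ _ ] _ = refl
    neg (+ _) (+<+ ())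

  Edge : Fin n → Fin n → Set ℓ
  Edge u v = Toward p q (dir u) × Toward p q (dir v) ×
    ((u ≡ v × (p ▷ dir u) ∈ B) ⊎ (u ≢ v × (p ▷ dir u ▷ dir v) ∈ B))

  Edge-sym : ∀ {u v} → Edge u v → Edge v u
  Edge-sym (tu , tv , inj₁ (refl , in-B)) = tv , tu , inj₁ (refl , in-B)
  Edge-sym {u} {v} (tu , tv , inj₂ (u≢v , in-B)) = tv , tu , inj₂ (u≢v ∘ sym , subst B (▷-comm p (dir u) (dir v)) in-B)

  loop-edge : ∀ {e} → Toward p q e → (p ▷ e) ∈ B → Edge (proj₁ e) (proj₁ e)
  loop-edge {e} te in-B = te′ , te′ , inj₁ (refl , subst (λ g → (p ▷ g) ∈ B) (Toward⇒dir te) in-B)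
    where te′ = subst (Toward p q) (Toward⇒dir te) te

  pair-edge : ∀ {e f} → Toward p q e → Toward p q f → f ≢ e → (p ▷ e ▷ f) ∈ B → Edge (proj₁ e) (proj₁ f)
  pair-edge {e} {f} te tf f≢e in-B =
    subst (Toward p q) (Toward⇒dir te) te , subst (Toward p q) (Toward⇒dir tf) tf ,
    inj₂ (Toward-base te tf f≢e , subst₂ (λ g h → (p ▷ g ▷ h) ∈ B) (Toward⇒dir te) (Toward⇒dir tf) in-B)

  open Hall em₀ Edge (λ _ _ → em)

  -- Here ⟨q - p, x⟩ = a(S) - a(N(S)), so Hall's condition at `S` says that `q` does not exceed `p`
  -- in `x`; `local⇒global` reduces this to moves from `p`.
  condition : Condition a a
  condition S = ℤ.drop‿+≤+ (+-cancelˡ-≤ ⟪ p , x ⟫ (begin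
    ⟪ p , x ⟫ ℤ.+ + wt a S         ≡⟨ ⟪⟫-wt p q x a S (N S) balance ⟨
    ⟪ q , x ⟫ ℤ.+ + wt a (N S)     ≤⟨ ℤ.+-monoˡ-≤ (+ wt a (N S)) q≤p ⟩
    ⟪ p , x ⟫ ℤ.+ + wt a (N S)     ∎))
    where
    open ℤ.≤-Reasoning
    x : Vec Trit n
    x = tabulate λ u → select (S u) (N S u) (signₜ (diff u))
    x-along : ∀ {e} → Toward p q e → x ⟦ e ⟧ ≡ select (S (proj₁ e)) (N S (proj₁ e)) 1ₜ
    x-along {u , Sign.+} (toward t) =
      trans (Vec.lookup∘tabulate _ u) (cong (select (S u) (N S u)) (signₜ-pos _ (diff-pos u t)))
    x-along {u , Sign.-} (toward t) = trans (cong negₜ (Vec.lookup∘tabulate _ u))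
      (trans (negₜ-select (S u) (N S u) _) (cong (select (S u) (N S u) ∘ negₜ) (signₜ-neg _ (diff-neg u (ℤ.neg-cancel-< t)))))
    select≡1 : ∀ s r → select s r 1ₜ ≡ 1ₜ → s ≡ true × r ≡ false
    select≡1 true false _ = refl , refl
    select≡1 true true ()
    select≡1 false true ()
    select≡1 false false ()
    select≢-1 : ∀ s r → select s r 1ₜ ≢ -1ₜ → r ≡ true → s ≡ true
    select≢-1 true  true _  _ = refl
    select≢-1 false true ≢1 _ = contradiction refl ≢1
    q≤p : ⟪ q , x ⟫ ℤ.≤ ⟪ p , x ⟫
    q≤p = local⇒global ex x _ ℕ.≤-refl p∈B q∈B local₁ local₂
      where
      -- An element valued 1 lies over S but not over N(S), whereas a loop would put it in N(S).
      local₁ : ∀ {e} → Toward p q e → x ⟦ e ⟧ ≡ 1ₜ → (p ▷ e) ∉ B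
      local₁ {e} te xe in-B with select≡1 (S (proj₁ e)) (N S (proj₁ e)) (trans (sym (x-along te)) xe)
      ... | Su , ¬Nu = case trans (sym ¬Nu) (N-intro S Su (loop-edge te in-B)) of λ ()
      -- The edge puts `f` in N(S); as `x` is not -1 there, `f` is in S as well, and the reversed
      -- edge puts `e` in N(S).
      local₂ : ∀ {e f} → Toward p q e → Toward p q f → f ≢ e → x ⟦ e ⟧ ≡ 1ₜ → x ⟦ f ⟧ ≢ -1ₜ → (p ▷ e ▷ f) ∉ B
      local₂ {e} {f} te tf f≢e xe xf in-B with select≡1 (S (proj₁ e)) (N S (proj₁ e)) (trans (sym (x-along te)) xe)
      ... | Su , ¬Nu = case trans (sym ¬Nu) (N-intro S Sv (Edge-sym edge)) of λ ()
        where
        edge = pair-edge te tf f≢e in-B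
        Sv : S (proj₁ f) ≡ true
        Sv = select≢-1 (S (proj₁ f)) (N S (proj₁ f)) (xf ∘ trans (x-along tf)) (N-intro S Su edge)
    balance : ∀ u → lookup q u ℤ.* tritToℤ (lookup x u) ℤ.+ + (if N S u then a u else 0)
                  ≡ lookup p u ℤ.* tritToℤ (lookup x u) ℤ.+ + (if S u then a u else 0)
    balance u rewrite Vec.lookup∘tabulate (λ u → select (S u) (N S u) (signₜ (diff u))) u = cases (S u) (N S u)
      where
      i = lookup p u
      j = lookup q u
      t = signₜ (diff u)
      expand : ∀ i j t → j ℤ.* t ℤ.+ 0ℤ ≡ i ℤ.* t ℤ.+ (j ℤ.- i) ℤ.* t
      expand = solve-∀
      expand⁻ : ∀ i j t → j ℤ.* (ℤ.- t) ℤ.+ (j ℤ.- i) ℤ.* t ≡ i ℤ.* (ℤ.- t) ℤ.+ 0ℤ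
      expand⁻ = solve-∀
      cases : ∀ s r → j ℤ.* tritToℤ (select s r t) ℤ.+ + (if r then a u else 0)
                    ≡ i ℤ.* tritToℤ (select s r t) ℤ.+ + (if s then a u else 0)
      cases true  true  = cong (ℤ._+ + a u) (trans (ℤ.*-zeroʳ j) (sym (ℤ.*-zeroʳ i)))
      cases false false = cong (ℤ._+ 0ℤ) (trans (ℤ.*-zeroʳ j) (sym (ℤ.*-zeroʳ i)))
      cases true  false = trans (expand i j (tritToℤ t)) (cong (ℤ._+_ (i ℤ.* tritToℤ t)) (i*signₜ (diff u)))
      cases false true  rewrite tritToℤ-neg t =
        trans (cong (ℤ._+_ (j ℤ.* (ℤ.- tritToℤ t))) (sym (i*signₜ (diff u)))) (expand⁻ i j (tritToℤ t))

  vec : Fin n → Point n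
  vec u = ℤ.sign (diff u) ·χ u

  -- A loop covers its coordinate once on each side of the double cover, so it contributes its unit
  -- vector twice.
  moves : Fin n × Fin n → List (Point n)
  moves (u , v) with u Fin.≟ v
  ... | yes _ = vec u ∷ vec u ∷ []
  ... | no _  = vec u ⊕ vec v ∷ []

  moves∈ : ∀ {u v} → Edge u v → All (_∈ Φ[ B ]⟨ p , q ⟩) (moves (u , v))
  moves∈ {u} {v} (tu , tv , in-B) with u Fin.≟ v | in-B
  ... | yes refl | inj₁ (_ , u∈B)   = α∈ ∷ α∈ ∷ []
    where α∈ = Φ-toward⇒Φ (inj₁ (dir u , tu , refl)) , u∈B
  ... | yes refl | inj₂ (u≢u , _)   = contradiction refl u≢u
  ... | no u≢v   | inj₁ (u≡v , _)   = contradiction u≡v u≢v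
  ... | no u≢v   | inj₂ (_ , uv∈B)  =
    (Φ-toward⇒Φ (inj₂ (dir u , dir v , (λ eq → u≢v (sym (cong proj₁ eq))) , tu , tv , refl)) ,
     subst B (sym (▷-pair p (dir u) (dir v))) uv∈B) ∷ []

  -- The sign is taken at `w` instead of `u`; the two can differ only where the delta vanishes. This
  -- lets the sign be factored out of the sum over a matching.
  lookup-vec : ∀ u w → lookup (vec u) w ≡ (ℤ.sign (diff w) ◃ 1) ℤ.* + δ u w
  lookup-vec u w with u Fin.≟ w
  ... | yes refl rewrite δ-same u = trans (lookup-χ (ℤ.sign (diff u)) u) (sym (ℤ.*-identityʳ _))
  ... | no u≢w rewrite δ-≢ u w u≢w = trans (lookup-χ-≢ (ℤ.sign (diff u)) u w u≢w) (sym (ℤ.*-zeroʳ (ℤ.sign (diff w) ◃ 1)))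

  total-++ : ∀ αs βs (w : Fin n) → total (αs List.++ βs) w ≡ total αs w ℤ.+ total βs w
  total-++ []       βs w = sym (ℤ.+-identityˡ _)
  total-++ (α ∷ αs) βs w = trans (cong (ℤ._+_ (lookup α w)) (total-++ αs βs w)) (sym (ℤ.+-assoc (lookup α w) _ _))

  total-moves : ∀ u v w → total (moves (u , v)) w ≡ lookup (vec u) w ℤ.+ lookup (vec v) w
  total-moves u v w with u Fin.≟ v
  ... | yes refl = cong (ℤ._+_ (lookup (vec u) w)) (ℤ.+-identityʳ _)
  ... | no _     = trans (ℤ.+-identityʳ _) (Vec.lookup-zipWith ℤ._+_ w (vec u) (vec v))

  -- Both ends of a matched pair count, so once each side meets the demand |q - p| the sum is 2(q -
  -- p).
  total-matching : ∀ L w → total (List.concatMap moves L) w ≡ (ℤ.sign (diff w) ◃ 1) ℤ.* + (count₁ L w ℕ.+ count₂ L w)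
  total-matching []            w = sym (ℤ.*-zeroʳ (ℤ.sign (diff w) ◃ 1))
  total-matching ((u , v) ∷ L) w = begin
    total (moves (u , v) List.++ List.concatMap moves L) w
      ≡⟨ total-++ (moves (u , v)) _ w ⟩
    total (moves (u , v)) w ℤ.+ total (List.concatMap moves L) w
      ≡⟨ cong₂ ℤ._+_ (total-moves u v w) (total-matching L w) ⟩
    (lookup (vec u) w ℤ.+ lookup (vec v) w) ℤ.+ s ℤ.* + (count₁ L w ℕ.+ count₂ L w)
      ≡⟨ cong₂ (λ i j → i ℤ.+ s ℤ.* j) (cong₂ ℤ._+_ (lookup-vec u w) (lookup-vec v w)) (ℤ.pos-+ (count₁ L w) _) ⟩
    (s ℤ.* + δ u w ℤ.+ s ℤ.* + δ v w) ℤ.+ s ℤ.* (+ count₁ L w ℤ.+ + count₂ L w)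
      ≡⟨ shuffle s (+ δ u w) (+ δ v w) (+ count₁ L w) (+ count₂ L w) ⟩
    s ℤ.* ((+ δ u w ℤ.+ + count₁ L w) ℤ.+ (+ δ v w ℤ.+ + count₂ L w))
      ≡⟨ cong (ℤ._*_ s) (cong₂ ℤ._+_ (sym (ℤ.pos-+ (δ u w) _)) (sym (ℤ.pos-+ (δ v w) _))) ⟩
    s ℤ.* (+ (δ u w ℕ.+ count₁ L w) ℤ.+ + (δ v w ℕ.+ count₂ L w))
      ≡⟨ cong (ℤ._*_ s) (ℤ.pos-+ (δ u w ℕ.+ count₁ L w) _) ⟨
    s ℤ.* + ((δ u w ℕ.+ count₁ L w) ℕ.+ (δ v w ℕ.+ count₂ L w)) ∎
    where
    open ≡-Reasoning
    s = ℤ.sign (diff w) ◃ 1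
    shuffle : ∀ s a b c d → (s ℤ.* a ℤ.+ s ℤ.* b) ℤ.+ s ℤ.* (c ℤ.+ d) ≡ s ℤ.* ((a ℤ.+ c) ℤ.+ (b ℤ.+ d))
    shuffle = solve-∀

  sign*2∣i∣ : ∀ i → (ℤ.sign i ◃ 1) ℤ.* + (∣ i ∣ ℕ.+ ∣ i ∣) ≡ + 2 ℤ.* i
  sign*2∣i∣ i = begin
    (ℤ.sign i ◃ 1) ℤ.* + (∣ i ∣ ℕ.+ ∣ i ∣)       ≡⟨ cong (ℤ._*_ (ℤ.sign i ◃ 1)) (ℤ.pos-+ ∣ i ∣ ∣ i ∣) ⟩
    (ℤ.sign i ◃ 1) ℤ.* (+ ∣ i ∣ ℤ.+ + ∣ i ∣)     ≡⟨ double (ℤ.sign i ◃ 1) (+ ∣ i ∣) ⟩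
    + 2 ℤ.* ((ℤ.sign i ◃ 1) ℤ.* + ∣ i ∣)         ≡⟨ cong (ℤ._*_ (+ 2)) (signed i) ⟩
    + 2 ℤ.* i                                    ∎
    where
    open ≡-Reasoning
    double : ∀ s k → s ℤ.* (k ℤ.+ k) ≡ + 2 ℤ.* (s ℤ.* k)
    double = solve-∀
    signed : ∀ i → (ℤ.sign i ◃ 1) ℤ.* + ∣ i ∣ ≡ i
    signed (+ k)    = ℤ.*-identityˡ (+ k)
    signed -[1+ k ] = ℤ.-1*i≡-i (+ suc k)

  path : ∃[ αs ] All (_∈ Φ[ B ]⟨ p , q ⟩) αs × toℚⱽ p ⊕ℚ sumℚⱽ (List.map half αs) ≡ toℚⱽ q
  path with hall _ a a refl refl condition
  ... | L , edges , a≡₁ , a≡₂ = List.concatMap moves L , All.concat⁺ (All.map⁺ (All.map moves∈ edges)) ,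
    half-path p q (List.concatMap moves L) λ w → begin
      total (List.concatMap moves L) w                       ≡⟨ total-matching L w ⟩
      s w ℤ.* + (count₁ L w ℕ.+ count₂ L w)                  ≡⟨ cong₂ (λ i j → s w ℤ.* + (i ℕ.+ j)) (a≡₁ w) (a≡₂ w) ⟨
      s w ℤ.* + (a w ℕ.+ a w)                                ≡⟨ sign*2∣i∣ (diff w) ⟩
      + 2 ℤ.* diff w                                         ∎
    where
    open ≡-Reasoning
    s : Fin n → ℤ
    s w = ℤ.sign (diff w) ◃ 1

-- Tight vectors and blocked edges are statements in `Set` whatever the level of `B`, so excluded
-- middle is applied to them at level 0.
lower-em : ExcludedMiddle ℓ → ExcludedMiddle 0ℓ
lower-em {ℓ} em {P} = map′ lower lift (em {Lift ℓ P})

theorem1 : ∀ {ℓ} → ExcludedMiddle ℓ → (n : ℕ) → .{{_ : NonZero n}} →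
    (B : Pred (Point n) ℓ) → Satisfiable B →
    (BS-Convex B ⇔ Δ-EXC B) × (Δ-EXC B ⇔ BS-EXC B)
theorem1 em n B (o , o∈B) =
    mk⇔ (λ (f , bs , B≐P) → Exchange⇒Δ-EXC (Exchange-≐ B≐P (BisubmodularExchange.exchange (lower-em em) f bs)))
        (λ Δ → SupportFunction.bs-convex em (Δ-EXC⇒Exchange Δ) o∈B)
  , mk⇔ (λ Δ p q p∈B q∈B → HalfPath.path em (lower-em em) (Δ-EXC⇒Exchange Δ) p∈B q∈B)
        BS-EXC⇒Δ-EXC
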